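{- Let $n$ be a positive integer and let $p>n+1$ be a prime. (i) If $n$ is odd, then $$\sum_{\substack{0<i_1<\cdots<i_n<p\\ i_1\equiv 1,2\ (\mathrm{mod}\ 6)}}\frac{1}{i_1\cdots i_n}\equiv \sum_{\substack{0<i_1<\cdots<i_n<p\\ i_1\equiv 4,5\ (\mathrm{mod}\ 6)}}\frac{1}{i_1\cdots i_n}\pmod p.$$ (ii) If $n$ is even, then $$\sum_{\substack{0<i_1<\cdots<i_n<p\\ i_1\equiv 0\ (\mathrm{mod}\ 3)}}\frac{(-1)^{i_1}}{i_1\cdots i_n}\equiv 2\sum_{\substack{0<i_1<\cdots<i_n<p\\ i_1\equiv 2,3,4\ (\mathrm{mod}\ 6)}}\frac{1}{i_1\cdots i_n}\pmod p.$$
   Context: All sums range over integers $i_1,\dots,i_n$. The summands are rational numbers whose denominators are not divisible by $p$; for such rationals $a,b$, $a\equiv b \pmod p$ means that $a-b$ lies in $p\mathbb{Z}_{(p)}$ (equivalently, $a-b$ is divisible by $p$ in the ring $\mathbb{Z}_p$ of $p$-adic integers). -}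

module Defs where

open import Data.Integer.Base as ℤ using (ℤ)
open import Data.List.Base as List using (List; []; _∷_)
open import Data.List.Membership.DecPropositional using (_∈?_)
open import Data.List.Membership.Propositional using (_∈_)
open import Data.Nat.Base as ℕ using (ℕ; zero; suc; NonZero)
open import Data.Nat.Divisibility using (_∤_)
open import Data.Nat.DivMod using (_%_)
open import Data.Nat.Properties using (_≟_; _<?_)
open import Data.Product.Base using (∃-syntax; _×_)
open import Data.Rational.Base as ℚ using (ℚ; 0ℚ; ↧ₙ_)
open import Data.Vec.Base as Vec using (Vec; []; _∷_; _∷ʳ_)
open import Data.Vec.Relation.Unary.Linked using (Linked; linked?)
open import Relation.Binary.PropositionalEquality using (_≡_)
open import Relation.Nullary.Decidable using (_×-dec_)
open import Relation.Unary using (Decidable)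

-- Membership in ℤ₍ₚ₎ for p prime: the denominator ↧ₙ is the reduced one.
_Integral-at_ : ℚ → ℕ → Set
c Integral-at p = p ∤ ↧ₙ c

-- a - b lies in p ℤ₍ₚ₎.
infix 4 _≡_[mod_]
_≡_[mod_] : ℚ → ℚ → ℕ → Set
a ≡ b [mod p ] = ∃[ c ] c Integral-at p × a ℚ.- b ≡ (ℤ.+ p ℚ./ 1) ℚ.* c

-- The clause for denominator 0 only makes the operation total; it is never
-- reached by the sums below, whose indices are all positive.
infixl 7 _÷ℕ_
_÷ℕ_ : ℤ → ℕ → ℚ
a ÷ℕ zero      = 0ℚ
a ÷ℕ d@(suc _) = a ℚ./ d

product : ∀ {n} → Vec ℕ n → ℕ
product = Vec.foldr _ ℕ._*_ 1

first : ∀ {n} .{{_ : NonZero n}} → Vec ℕ n → ℕ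
first (i ∷ _) = i

tuples : ∀ n → List ℕ → List (Vec ℕ n)
tuples zero    xs = [] ∷ []
tuples (suc n) xs = List.cartesianProductWith _∷_ xs (tuples n xs)

module _ (n : ℕ) .{{_ : NonZero n}} (p m : ℕ) .{{_ : NonZero m}} (R : List ℕ) where

  -- 0 < i₁ < ⋯ < iₙ < p and i₁ mod m ∈ R, where R consists of least
  -- nonnegative residues.
  Admissible : Vec ℕ n → Set
  Admissible is = Linked ℕ._<_ (0 ∷ (is ∷ʳ p)) × first is % m ∈ R

  admissible? : Decidable Admissible
  admissible? is =
    linked? _<?_ (0 ∷ (is ∷ʳ p)) ×-dec _∈?_ _≟_ (first is % m) R

  -- Every admissible tuple has its entries in upTo p = 0, …, p - 1, and
  -- tuples n (upTo p) lists each n-tuple of those exactly once.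
  ∑ : (Vec ℕ n → ℚ) → ℚ
  ∑ f = List.foldr ℚ._+_ 0ℚ
          (List.map f (List.filter admissible? (tuples n (List.upTo p))))

{-# OPTIONS --safe #-}
module Submission where

-- Let f_n(x) = ∑ x^i₁ / (i₁ ⋯ iₙ) over 0 < i₁ < ⋯ < iₙ < p. Modulo p one has
-- f_n(1 - x) = (-1)ⁿ⁻¹ f_n(x) for 0 < n < p - 1: as x f_n′(x) = ∑ x^i₁ / (i₂ ⋯ iₙ) is a
-- geometric sum in i₁, this follows by induction on n from f_n(1) = 0, which is Lagrange's
-- theorem that the elementary symmetric functions of 1, 1/2, …, 1/(p - 1) vanish mod p in
-- degrees 1, …, p - 2. On coefficients, x ↦ 1 - x is a binomial transform.
-- At a primitive sixth root of unity ω one has 1 - ω = ω⁻¹, so f_n(ω⁻¹) = (-1)ⁿ⁻¹ f_n(ω), and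
-- both parts are read off from the values of ω^i - ω^-i (n odd) and ω^i + ω^-i - 1 (n even,
-- using f_n(1) = 0 again) in terms of i mod 6. Instead of adjoining ω, the functional
-- equation is paired with the sequences satisfying a(i + 2) = a(i + 1) - a(i).

open import Defs
open import Data.Integer.Base using (+_; 1ℤ; -1ℤ; _^_)
open import Data.List.Base using ([]; _∷_)
open import Data.Nat.Base using (ℕ; _<_; NonZero)
open import Data.Nat.Divisibility using (_∣_; _∤_)
open import Data.Nat.Primality using (Prime)
open import Data.Rational.Base using (_/_)

open import Algebra.Bundles using (CommutativeRing)
import Algebra.Solver.Ring as RingSolver
open import Algebra.Solver.Ring.AlmostCommutativeRing using (fromCommutativeRing; _-Raw-AlmostCommutative⟶_)
open import Data.Bool.Base using (Bool; true; false; if_then_else_; _∧_)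
open import Data.Empty using (⊥-elim)
open import Data.Integer.Base as ℤ using (ℤ; -[1+_]; _⊖_)
open import Data.Integer.GCD using (gcd)
import Data.Integer.Properties as ℤₚ
open import Data.List.Base as List using (List; _++_)
open import Data.List.Membership.DecPropositional using (_∈?_)
import Data.List.Properties as Listₚ
open import Data.Maybe.Base using (Maybe; just; nothing)
open import Data.Nat.Base as ℕ using (zero; suc; _≤_; z≤n; s≤s; _<ᵇ_)
open import Data.Nat.Divisibility
  using (_∣?_; _∣0; divides; ∣-refl; ∣-trans; ∣1⇒≡1; >⇒∤; ∣m∣n⇒∣m+n; ∣m+n∣m⇒∣n)
open import Data.Nat.DivMod using (_%_)
open import Data.Nat.Primality using (euclidsLemma; ¬prime[1])
import Data.Nat.Properties as ℕₚ
open import Data.Product.Base using (_,_)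
open import Data.Rational.Base as ℚ using (ℚ; 0ℚ; 1ℚ)
import Data.Rational.Properties as ℚₚ
import Data.Rational.Unnormalised.Base as ℚᵘ
import Data.Rational.Unnormalised.Properties as ℚᵘₚ
open import Data.Sum.Base using (inj₁; inj₂)
open import Data.Vec.Base using (Vec; []; _∷_; _∷ʳ_)
open import Data.Vec.Relation.Unary.Linked using (linked?)
open import Function.Base using (_∘_)
open import Relation.Binary.Definitions using (tri<; tri≈; tri>)
open import Relation.Binary.PropositionalEquality as ≡ using (_≡_; _≢_)
import Relation.Binary.Reasoning.Setoid as SetoidReasoning
open import Relation.Nullary.Decidable using (dec-true)
open import Relation.Nullary.Decidable.Core using (does; yes; no)
open import Relation.Nullary.Negation.Core using (contradiction)
open import Relation.Unary using (Decidable)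

-- Why the sign alternates and the induction closes: for 0 < m < p - 1 the vanishing of f_m(1) gives
-- x(1 - x) f_{m+1}′(x) = -f_m(x) modulo p. The factor x(1 - x) is symmetric under x ↦ 1 - x while
-- differentiation changes sign, so each step turns the sign once. The start is f_1′(x) = (1 -
-- x^(p-1))/(1 - x), handled by (1 - x)^(p-1) = 1 + x + ⋯ + x^(p-1). Integrating back divides by
-- exponents 1, ..., p - 1, all invertible, and loses only the constant term, which is f_{m+1}(1).
-- That is why Lagrange's theorem is needed separately, and why the range stops at p - 2: the
-- symmetric function of degree p - 1 is 1/(p - 1)!, a unit. Lagrange's theorem is drawn from the
-- invariance of t ∏ (1 + t/j) under t ↦ t + 1, so no roots of polynomials are counted. All this
-- takes place in an arbitrary commutative ring where N + 1 = 0 and 1, ..., N are invertible.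

module IntegerRingSolver {c ℓ} (R : CommutativeRing c ℓ) where
  open CommutativeRing R
  open import Algebra.Properties.Ring ring
  open import Algebra.Properties.AbelianGroup +-abelianGroup using (⁻¹-∙-comm)
  open import Algebra.Properties.Semiring.Mult.TCOptimised semiring
  open import Algebra.Properties.CommutativeSemigroup +-commutativeSemigroup using (interchange)
  open import Relation.Binary.Reasoning.Setoid setoid

  private
    -- The optimised multiple makes `1 × 1#` reduce to `1#`, so the literals 0 and 1 of the solver
    -- mean `0#` and `1#` definitionally.
    ⟦_⟧ : ℤ → Carrier
    ⟦ + n ⟧      = n × 1#
    ⟦ -[1+ n ] ⟧ = - (suc n × 1#)

    ⊖-homo : ∀ m n → ⟦ m ⊖ n ⟧ ≈ m × 1# - n × 1#
    ⊖-homo m       zero    = begin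
      m × 1#          ≈⟨ +-identityʳ _ ⟨
      m × 1# + 0#     ≈⟨ +-congˡ -0#≈0# ⟨
      m × 1# - 0#     ∎
    ⊖-homo zero    (suc n) = sym (+-identityˡ _)
    ⊖-homo (suc m) (suc n) = begin
      ⟦ suc m ⊖ suc n ⟧                      ≡⟨ ≡.cong ⟦_⟧ (ℤₚ.[1+m]⊖[1+n]≡m⊖n m n) ⟩
      ⟦ m ⊖ n ⟧                              ≈⟨ ⊖-homo m n ⟩
      m × 1# - n × 1#                        ≈⟨ +-identityˡ _ ⟨
      0# + (m × 1# - n × 1#)                 ≈⟨ +-congʳ (-‿inverseʳ 1#) ⟨
      1# - 1# + (m × 1# - n × 1#)            ≈⟨ interchange _ _ _ _ ⟩
      (1# + m × 1#) + (- 1# - n × 1#)        ≈⟨ +-congˡ (⁻¹-∙-comm _ _) ⟩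
      (1# + m × 1#) - (1# + n × 1#)          ≈⟨ +-cong (×-homo-+ 1# 1 m) (-‿cong (×-homo-+ 1# 1 n)) ⟨
      suc m × 1# - suc n × 1#                ∎

    +-homo : ∀ i j → ⟦ i ℤ.+ j ⟧ ≈ ⟦ i ⟧ + ⟦ j ⟧
    +-homo (+ m)    (+ n)    = ×-homo-+ 1# m n
    +-homo (+ m)    -[1+ n ] = ⊖-homo m (suc n)
    +-homo -[1+ m ] (+ n)    = trans (⊖-homo n (suc m)) (+-comm _ _)
    +-homo -[1+ m ] -[1+ n ] = begin
      - (suc (suc (m ℕ.+ n)) × 1#)      ≡⟨ ≡.cong (λ k → - (k × 1#)) (≡.cong suc (ℕₚ.+-suc m n)) ⟨
      - ((suc m ℕ.+ suc n) × 1#)        ≈⟨ -‿cong (×-homo-+ 1# (suc m) (suc n)) ⟩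
      - (suc m × 1# + suc n × 1#)       ≈⟨ ⁻¹-∙-comm _ _ ⟨
      - (suc m × 1#) - (suc n × 1#)     ∎
      where import Data.Nat.Properties as ℕₚ

    -‿homo : ∀ i → ⟦ ℤ.- i ⟧ ≈ - ⟦ i ⟧
    -‿homo (+ zero)  = sym -0#≈0#
    -‿homo (+ suc n) = refl
    -‿homo -[1+ n ]  = sym (-‿involutive _)

    +*-homo : ∀ m j → ⟦ + m ℤ.* j ⟧ ≈ (m × 1#) * ⟦ j ⟧
    +*-homo m (+ n)    = begin
      ⟦ + m ℤ.* + n ⟧  ≡⟨ ≡.cong ⟦_⟧ (ℤₚ.pos-* m n) ⟨
      (m ℕ.* n) × 1#   ≈⟨ ×1-homo-* m n ⟩
      (m × 1#) * (n × 1#) ∎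
    +*-homo m -[1+ n ] = begin
      ⟦ + m ℤ.* ℤ.- (+ suc n) ⟧    ≡⟨ ≡.cong ⟦_⟧ (ℤₚ.neg-distribʳ-* (+ m) (+ suc n)) ⟨
      ⟦ ℤ.- (+ m ℤ.* + suc n) ⟧    ≈⟨ -‿homo (+ m ℤ.* + suc n) ⟩
      - ⟦ + m ℤ.* + suc n ⟧        ≈⟨ -‿cong (+*-homo m (+ suc n)) ⟩
      - (m × 1# * suc n × 1#)      ≈⟨ -‿distribʳ-* _ _ ⟩
      m × 1# * - (suc n × 1#)      ∎

    *-homo : ∀ i j → ⟦ i ℤ.* j ⟧ ≈ ⟦ i ⟧ * ⟦ j ⟧
    *-homo (+ m)    j = +*-homo m j
    *-homo -[1+ m ] j = begin
      ⟦ ℤ.- (+ suc m) ℤ.* j ⟧      ≡⟨ ≡.cong ⟦_⟧ (ℤₚ.neg-distribˡ-* (+ suc m) j) ⟨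
      ⟦ ℤ.- (+ suc m ℤ.* j) ⟧      ≈⟨ -‿homo (+ suc m ℤ.* j) ⟩
      - ⟦ + suc m ℤ.* j ⟧          ≈⟨ -‿cong (+*-homo (suc m) j) ⟩
      - (suc m × 1# * ⟦ j ⟧)       ≈⟨ -‿distribˡ-* _ _ ⟩
      - (suc m × 1#) * ⟦ j ⟧       ∎

    ℤ⟶R : ℤ.+-*-rawRing -Raw-AlmostCommutative⟶ fromCommutativeRing R
    ℤ⟶R = record
      { ⟦_⟧ = ⟦_⟧ ; +-homo = +-homo ; *-homo = *-homo
      ; -‿homo = -‿homo ; 0-homo = refl ; 1-homo = refl }

    _≟_ : ∀ i j → Maybe (⟦ i ⟧ ≈ ⟦ j ⟧)
    i ≟ j with i ℤₚ.≟ j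
    ... | yes i≡j = just (reflexive (≡.cong ⟦_⟧ i≡j))
    ... | no  _   = nothing

  open RingSolver ℤ.+-*-rawRing (fromCommutativeRing R) ℤ⟶R _≟_ public

-- Finite sums, signed binomial coefficients and sequences of period six

module RingLemmas {c ℓ} (R : CommutativeRing c ℓ) where
  open CommutativeRing R hiding (zero)
  open IntegerRingSolver R
  open import Algebra.Properties.Ring ring using (-0#≈0#)
  open import Algebra.Properties.Semiring.Mult semiring using (_×_)
  open import Relation.Binary.Reasoning.Setoid setoid

  ι : ℕ → Carrier
  ι n = n × 1#

  HasCharacteristic : ℕ → Set ℓ
  HasCharacteristic p = ι p ≈ 0#

  InvertsUpTo : ℕ → (ℕ → Carrier) → Set ℓ
  InvertsUpTo N inv = ∀ k → k < N → ι (suc k) * inv (suc k) ≈ 1#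

  sgn : ℕ → Carrier
  sgn zero    = 1#
  sgn (suc n) = - sgn n

  sgn² : ∀ n → sgn n * sgn n ≈ 1#
  sgn² zero    = *-identityˡ 1#
  sgn² (suc n) = trans (solve 1 (λ s → :- s :* :- s := s :* s) refl (sgn n)) (sgn² n)

  sumTo : ℕ → (ℕ → Carrier) → Carrier
  sumTo zero    f = 0#
  sumTo (suc n) f = f 0 + sumTo n (λ i → f (suc i))

  sumTo-cong : ∀ n {f g} → (∀ i → i < n → f i ≈ g i) → sumTo n f ≈ sumTo n g
  sumTo-cong zero    f≈g = refl
  sumTo-cong (suc n) f≈g = +-cong (f≈g 0 (s≤s z≤n)) (sumTo-cong n (λ i i<n → f≈g (suc i) (s≤s i<n)))

  sumTo-zero : ∀ n {f} → (∀ i → i < n → f i ≈ 0#) → sumTo n f ≈ 0#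
  sumTo-zero zero    f≈0 = refl
  sumTo-zero (suc n) f≈0 = trans
    (+-cong (f≈0 0 (s≤s z≤n)) (sumTo-zero n (λ i i<n → f≈0 (suc i) (s≤s i<n))))
    (+-identityˡ 0#)

  sumTo-+ : ∀ n f g → sumTo n (λ i → f i + g i) ≈ sumTo n f + sumTo n g
  sumTo-+ zero    f g = sym (+-identityˡ 0#)
  sumTo-+ (suc n) f g = trans (+-congˡ (sumTo-+ n (f ∘ suc) (g ∘ suc)))
    (solve 4 (λ x y z w → x :+ y :+ (z :+ w) := x :+ z :+ (y :+ w)) refl _ _ _ _)

  sumTo-*ˡ : ∀ n x f → x * sumTo n f ≈ sumTo n (λ i → x * f i)
  sumTo-*ˡ zero    x f = zeroʳ x
  sumTo-*ˡ (suc n) x f = trans (distribˡ x _ _) (+-congˡ (sumTo-*ˡ n x (f ∘ suc)))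

  sumTo-neg : ∀ n f → sumTo n (λ i → - f i) ≈ - sumTo n f
  sumTo-neg zero    f = sym -0#≈0#
  sumTo-neg (suc n) f = trans (+-congˡ (sumTo-neg n (f ∘ suc)))
    (solve 2 (λ x y → :- x :+ :- y := :- (x :+ y)) refl _ _)

  sumTo-minus : ∀ n f g → sumTo n (λ i → f i - g i) ≈ sumTo n f - sumTo n g
  sumTo-minus n f g = trans (sumTo-+ n f (λ i → - g i)) (+-congˡ (sumTo-neg n g))

  sumTo-last : ∀ n f → sumTo (suc n) f ≈ sumTo n f + f n
  sumTo-last zero    f = +-comm _ _
  sumTo-last (suc n) f = trans (+-congˡ (sumTo-last n (f ∘ suc))) (sym (+-assoc _ _ _))

  sumTo-telescope : ∀ n (f : ℕ → Carrier) → sumTo n (λ i → f i - f (suc i)) ≈ f 0 - f n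
  sumTo-telescope zero    f = sym (-‿inverseʳ (f 0))
  sumTo-telescope (suc n) f = trans (+-congˡ (sumTo-telescope n (f ∘ suc)))
    (solve 3 (λ x y z → x :- y :+ (y :- z) := x :- z) refl _ _ _)

  sumTo-swap : ∀ m n (f : ℕ → ℕ → Carrier) →
    sumTo m (λ i → sumTo n (f i)) ≈ sumTo n (λ j → sumTo m (λ i → f i j))
  sumTo-swap zero    n f = sym (sumTo-zero n (λ _ _ → refl))
  sumTo-swap (suc m) n f = trans (+-congˡ (sumTo-swap m n (f ∘ suc)))
    (sym (sumTo-+ n (f 0) (λ j → sumTo m (λ i → f (suc i) j))))

  sumTo-two : ∀ n k f → suc k < n →
    (∀ i → i < n → i ≢ k → i ≢ suc k → f i ≈ 0#) → sumTo n f ≈ f k + f (suc k)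
  sumTo-two (suc (suc n)) zero f _ f≈0 = +-congˡ (trans
    (+-congˡ (sumTo-zero n (λ i i<n → f≈0 (suc (suc i)) (s≤s (s≤s i<n)) (λ ()) (λ ()))))
    (+-identityʳ _))
  sumTo-two (suc n) (suc k) f (s≤s k<n) f≈0 = trans
    (+-cong (f≈0 0 (s≤s z≤n) (λ ()) (λ ()))
      (sumTo-two n k (f ∘ suc) k<n (λ i i<n i≢ i≢′ →
        f≈0 (suc i) (s≤s i<n) (i≢ ∘ ℕₚ.suc-injective) (i≢′ ∘ ℕₚ.suc-injective))))
    (+-identityˡ _)

  when : Bool → Carrier → Carrier
  when b x = if b then x else 0#

  sumTo-above : ∀ n k (f : ℕ → Carrier) → suc k < n →
    sumTo n (λ i → when (k <ᵇ i) (f i)) ≈ f (suc k) + sumTo n (λ i → when (suc k <ᵇ i) (f i))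
  sumTo-above (suc (suc n)) zero    f _         = trans (+-identityˡ _)
    (+-congˡ (sym (trans (+-identityˡ _) (+-identityˡ _))))
  sumTo-above (suc n)       (suc k) f (s≤s k<n) = trans (+-congˡ (sumTo-above n k (f ∘ suc) k<n))
    (solve 3 (λ x y z → x :+ (y :+ z) := y :+ (x :+ z)) refl _ _ _)

  sumTo-above-all : ∀ n (f : ℕ → Carrier) → sumTo (suc n) (λ i → when (n <ᵇ i) (f i)) ≈ 0#
  sumTo-above-all zero    f = +-identityˡ 0#
  sumTo-above-all (suc n) f = trans (+-identityˡ _) (sumTo-above-all n (f ∘ suc))

  -- sbinom i k = (-1)ᵏ (i choose k).
  sbinom : ℕ → ℕ → Carrier
  sbinom _       zero    = 1#
  sbinom zero    (suc k) = 0#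
  sbinom (suc i) (suc k) = sbinom i (suc k) - sbinom i k

  -- Since `sbinom i k` is the coefficient of x^k in (1 - x)^i, this is the derivative of (1 -
  -- x)^(i+1) read off coefficientwise.
  sbinom-absorb : ∀ i k → ι (suc k) * sbinom (suc i) (suc k) ≈ - (ι (suc i) * sbinom i k)
  -- `ι 1` unfolds to `1# + 0#`, so it enters the solver as `con (+ 1) :+ con (+ 0)`.
  sbinom-absorb zero    zero    = solve 0 ((con (+ 1) :+ con (+ 0)) :* (con (+ 0) :- con (+ 1)) := :- ((con (+ 1) :+ con (+ 0)) :* con (+ 1))) refl
  sbinom-absorb zero    (suc k) = solve 1 (λ x → x :* (con (+ 0) :- con (+ 0)) := :- ((con (+ 1) :+ con (+ 0)) :* con (+ 0))) refl (ι (suc (suc k)))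
  sbinom-absorb (suc i) zero    = begin
    ι 1 * (sbinom (suc i) 1 - 1#)       ≈⟨ solve 2 (λ u x → u :* (x :- con (+ 1)) := u :* x :- u) refl (ι 1) (sbinom (suc i) 1) ⟩
    ι 1 * sbinom (suc i) 1 - ι 1        ≈⟨ +-congʳ (sbinom-absorb i zero) ⟩
    - (ι (suc i) * 1#) - ι 1             ≈⟨ solve 1 (λ x → :- (x :* con (+ 1)) :- (con (+ 1) :+ con (+ 0)) := :- ((con (+ 1) :+ x) :* con (+ 1))) refl (ι (suc i)) ⟩
    - (ι (suc (suc i)) * 1#)             ∎
  sbinom-absorb (suc i) (suc k) = begin
    (1# + ι (suc k)) * (x - y)
      ≈⟨ solve 3 (λ u x y → (con (+ 1) :+ u) :* (x :- y) := (con (+ 1) :+ u) :* x :- (u :* y :+ y)) refl (ι (suc k)) x y ⟩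
    (1# + ι (suc k)) * x - (ι (suc k) * y + y)
      ≈⟨ +-cong (sbinom-absorb i (suc k)) (-‿cong (+-congʳ (sbinom-absorb i k))) ⟩
    - (ι (suc i) * sbinom i (suc k)) - (- (ι (suc i) * sbinom i k) + y)
      ≈⟨ solve 3 (λ u x y → :- (u :* x) :- (:- (u :* y) :+ (x :- y)) := :- ((con (+ 1) :+ u) :* (x :- y))) refl (ι (suc i)) (sbinom i (suc k)) (sbinom i k) ⟩
    - (ι (suc (suc i)) * y) ∎
    where
    x = sbinom (suc i) (suc (suc k))
    y = sbinom (suc i) (suc k)

  sbinom-zero : ∀ i k → i < k → sbinom i k ≈ 0#
  sbinom-zero zero    (suc k) _         = refl
  sbinom-zero (suc i) (suc k) (s≤s i<k) = trans
    (+-cong (sbinom-zero i (suc k) (ℕₚ.m<n⇒m<1+n i<k)) (-‿cong (sbinom-zero i k i<k)))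
    (-‿inverseʳ 0#)

  sbinom-diag : ∀ n → sbinom n n ≈ sgn n
  sbinom-diag zero    = refl
  sbinom-diag (suc n) = trans
    (+-cong (sbinom-zero n (suc n) ℕₚ.≤-refl) (-‿cong (sbinom-diag n)))
    (+-identityˡ _)

  sbinom-subdiag : ∀ n → sbinom (suc n) n ≈ sgn n * ι (suc n)
  sbinom-subdiag zero    = solve 0 (con (+ 1) := con (+ 1) :* (con (+ 1) :+ con (+ 0))) refl
  sbinom-subdiag (suc n) = trans
    (+-cong (sbinom-diag (suc n)) (-‿cong (sbinom-subdiag n)))
    (solve 2 (λ s u → :- s :- s :* u := :- s :* (con (+ 1) :+ u)) refl (sgn n) (ι (suc n)))

  -- The recurrence has characteristic polynomial X² - X + 1, the sixth cyclotomic polynomial; these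
  -- sequences stand for combinations of ω^i and ω^-i.
  hexa : Carrier → Carrier → ℕ → Carrier
  hexa a b zero    = a
  hexa a b (suc n) = hexa b (b - a) n

  hexa-cong : ∀ {a a′ b b′} n → a ≈ a′ → b ≈ b′ → hexa a b n ≈ hexa a′ b′ n
  hexa-cong zero    a≈a′ b≈b′ = a≈a′
  hexa-cong (suc n) a≈a′ b≈b′ = hexa-cong n b≈b′ (+-cong b≈b′ (-‿cong a≈a′))

  hexa-neg : ∀ a b n → hexa (- a) (- b) n ≈ - hexa a b n
  hexa-neg a b zero    = refl
  hexa-neg a b (suc n) = trans
    (hexa-cong n refl (solve 2 (λ a b → :- b :- :- a := :- (b :- a)) refl a b))
    (hexa-neg b (b - a) n)

  hexa-minus : ∀ a b a′ b′ n → hexa a b n - hexa a′ b′ n ≈ hexa (a - a′) (b - b′) n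
  hexa-minus a b a′ b′ zero    = refl
  hexa-minus a b a′ b′ (suc n) = trans (hexa-minus b (b - a) b′ (b′ - a′) n)
    (hexa-cong n refl (solve 4 (λ a b a′ b′ → b :- a :- (b′ :- a′) := b :- b′ :- (a :- a′)) refl a b a′ b′))

  -- With E the shift, E² = E - 1 gives 1 - E = E⁻¹: the binomial transform reverses the sequence.
  hexa-transform : ∀ n i a b → i < n → sumTo n (λ k → sbinom i k * hexa a b k) ≈ hexa a (a - b) i
  hexa-transform (suc n) zero    a b _ = begin
    1# * a + sumTo n (λ k → 0# * hexa b (b - a) k) ≈⟨ +-cong (*-identityˡ a) (sumTo-zero n (λ k _ → zeroˡ _)) ⟩
    a + 0#                                         ≈⟨ +-identityʳ a ⟩
    a                                              ∎
  hexa-transform (suc n) (suc i) a b (s≤s i<n) = begin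
    1# * a + sumTo n (λ k → (sbinom i (suc k) - sbinom i k) * h k)
      ≈⟨ +-congˡ (sumTo-cong n (λ k _ → solve 3 (λ x y z → (x :- y) :* z := x :* z :- y :* z) refl _ _ _)) ⟩
    1# * a + sumTo n (λ k → sbinom i (suc k) * h k - sbinom i k * h k)
      ≈⟨ +-congˡ (sumTo-minus n _ _) ⟩
    1# * a + (sumTo n (λ k → sbinom i (suc k) * h k) - sumTo n (λ k → sbinom i k * h k))
      ≈⟨ +-assoc _ _ _ ⟨
    sumTo (suc n) (λ k → sbinom i k * hexa a b k) - sumTo n (λ k → sbinom i k * h k)
      ≈⟨ +-cong (hexa-transform (suc n) i a b (ℕₚ.m<n⇒m<1+n i<n)) (-‿cong (hexa-transform n i b (b - a) i<n)) ⟩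
    hexa a (a - b) i - hexa b (b - (b - a)) i
      ≈⟨ hexa-minus _ _ _ _ i ⟩
    hexa (a - b) (a - b - (b - (b - a))) i
      ≈⟨ hexa-cong i refl (solve 2 (λ a b → a :- b :- (b :- (b :- a)) := a :- b :- a) refl a b) ⟩
    hexa (a - b) (a - b - a) i ∎
    where
    h = hexa b (b - a)

-- Elementary symmetric functions of reciprocals modulo p = N + 1

module Reciprocals {c ℓ} (R : CommutativeRing c ℓ) (N : ℕ) (inv : ℕ → CommutativeRing.Carrier R)
  (ι-inverse : RingLemmas.InvertsUpTo R N inv) (ι-char : RingLemmas.HasCharacteristic R (suc N)) where

  open CommutativeRing R hiding (zero)
  open RingLemmas R
  open IntegerRingSolver R
  open import Algebra.Properties.Ring ring using (-0#≈0#; -‿distribʳ-*)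
  open import Relation.Binary.Reasoning.Setoid setoid

  ι-cancel : ∀ {k x y} → k < N → ι (suc k) * x ≈ ι (suc k) * y → x ≈ y
  ι-cancel {k} {x} {y} k<N eq = trans (sym (undo x)) (trans (*-congˡ eq) (undo y))
    where
    undo : ∀ z → inv (suc k) * (ι (suc k) * z) ≈ z
    undo z = begin
      inv (suc k) * (ι (suc k) * z)   ≈⟨ solve 3 (λ i u z → i :* (u :* z) := u :* i :* z) refl _ _ _ ⟩
      ι (suc k) * inv (suc k) * z     ≈⟨ *-congʳ (ι-inverse k k<N) ⟩
      1# * z                          ≈⟨ *-identityˡ z ⟩
      z                               ∎

  sbinom-char : ∀ k → k < N → sbinom (suc N) (suc k) ≈ 0#
  sbinom-char k k<N = ι-cancel k<N (begin
    ι (suc k) * sbinom (suc N) (suc k)   ≈⟨ sbinom-absorb N k ⟩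
    - (ι (suc N) * sbinom N k)           ≈⟨ -‿cong (*-congʳ ι-char) ⟩
    - (0# * sbinom N k)                  ≈⟨ solve 2 (λ x y → :- (con (+ 0) :* x) := y :* con (+ 0)) refl _ _ ⟩
    ι (suc k) * 0#                       ∎)

  -- Coefficientwise, (1 - x)^(p-1) = (1 - x^p)/(1 - x) = 1 + x + ⋯ + x^(p-1) modulo p. It is the
  -- base case of `dual-esymm`.
  sbinom-top : ∀ k → k ≤ N → sbinom N k ≈ 1#
  sbinom-top zero    _   = refl
  sbinom-top (suc k) k<N = begin
    sbinom N (suc k)                    ≈⟨ solve 2 (λ x y → x := (x :- y) :+ y) refl _ _ ⟩
    sbinom (suc N) (suc k) + sbinom N k ≈⟨ +-cong (sbinom-char k k<N) (sbinom-top k (ℕₚ.<⇒≤ k<N)) ⟩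
    0# + 1#                             ≈⟨ +-identityˡ 1# ⟩
    1#                                  ∎

  -- esymm m k is the m-th elementary symmetric function of the inverses of k + 1, …, N.
  esymm : ℕ → ℕ → Carrier
  esymm zero    k = 1#
  esymm (suc m) k = sumTo (suc N) (λ i → when (k <ᵇ i) (inv i * esymm m i))

  esymm-step : ∀ m k → k < N → esymm (suc m) k ≈ inv (suc k) * esymm m (suc k) + esymm (suc m) (suc k)
  esymm-step m k k<N = sumTo-above (suc N) k (λ i → inv i * esymm m i) (s≤s k<N)

  esymm-top : ∀ m → esymm (suc m) N ≈ 0#
  esymm-top m = sumTo-above-all N (λ i → inv i * esymm m i)

  esymm-degree : ∀ d k m → d ℕ.+ k ≡ N → d < m → esymm m k ≈ 0#
  esymm-degree zero    k (suc m) ≡.refl _       = esymm-top m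
  esymm-degree (suc d) k (suc m) d+k≡N (s≤s d<m) = begin
    esymm (suc m) k                                            ≈⟨ esymm-step m k k<N ⟩
    inv (suc k) * esymm m (suc k) + esymm (suc m) (suc k)      ≈⟨ +-cong (*-congˡ (esymm-degree d (suc k) m d+1+k≡N d<m))
                                                                   (esymm-degree d (suc k) (suc m) d+1+k≡N (ℕₚ.m<n⇒m<1+n d<m)) ⟩
    inv (suc k) * 0# + 0#                                      ≈⟨ solve 1 (λ x → x :* con (+ 0) :+ con (+ 0) := con (+ 0)) refl _ ⟩
    0#                                                         ∎
    where
    d+1+k≡N = ≡.trans (ℕₚ.+-suc d k) d+k≡N
    k<N = ≡.subst (suc k ≤_) d+1+k≡N (ℕₚ.m≤n+m (suc k) d)

  ι*esymm : ∀ m k → k < N → ι (suc k) * esymm (suc m) k ≈ ι (suc k) * esymm (suc m) (suc k) + esymm m (suc k)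
  ι*esymm m k k<N = begin
    u * esymm (suc m) k      ≈⟨ *-congˡ (esymm-step m k k<N) ⟩
    u * (inv (suc k) * x + y) ≈⟨ solve 4 (λ u i x y → u :* (i :* x :+ y) := u :* y :+ (u :* i) :* x) refl _ _ _ _ ⟩
    u * y + (u * inv (suc k)) * x ≈⟨ +-congˡ (*-congʳ (ι-inverse k k<N)) ⟩
    u * y + 1# * x           ≈⟨ +-congˡ (*-identityˡ x) ⟩
    u * y + x                ∎
    where
    u = ι (suc k)
    x = esymm m (suc k)
    y = esymm (suc m) (suc k)

  -- Lagrange's theorem

  -- shifted k n is the coefficient of xⁿ in G (1 - x), where G t = ∏ (1 + t / j) over k < j ≤ N.
  shifted : ℕ → ℕ → Carrier
  shifted k n = sumTo (suc N) (λ i → esymm i k * sbinom i n)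

  shifted-top : ∀ n → shifted N n ≈ sbinom 0 n
  shifted-top n = begin
    1# * sbinom 0 n + sumTo N (λ i → esymm (suc i) N * sbinom (suc i) n)
      ≈⟨ +-cong (*-identityˡ _) (sumTo-zero N (λ i _ → trans (*-congʳ (esymm-top i)) (zeroˡ _))) ⟩
    sbinom 0 n + 0# ≈⟨ +-identityʳ _ ⟩
    sbinom 0 n ∎

  -- Only N - k - 1 indices lie above k + 1, so the term of degree N is zero. This matches the
  -- length of the sum left over in `ι*shifted`.
  shifted-drop : ∀ k n → k < N → shifted (suc k) n ≈ sumTo N (λ i → esymm i (suc k) * sbinom i n)
  shifted-drop k n k<N = begin
    shifted (suc k) n ≈⟨ sumTo-last N _ ⟩
    sumTo N (λ i → esymm i (suc k) * sbinom i n) + esymm N (suc k) * sbinom N n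
      ≈⟨ +-congˡ (trans (*-congʳ (esymm-degree (N ℕ.∸ suc k) (suc k) N (ℕₚ.m∸n+n≡m k<N) (ℕₚ.∸-monoʳ-< (s≤s z≤n) k<N))) (zeroˡ _)) ⟩
    sumTo N (λ i → esymm i (suc k) * sbinom i n) + 0# ≈⟨ +-identityʳ _ ⟩
    sumTo N (λ i → esymm i (suc k) * sbinom i n) ∎

  -- Write G_k for the product G with lower bound k. Then (k + 1) G_k(t) = (k + 1) G_{k+1}(t) + t
  -- G_{k+1}(t), taken at t = 1 - x; the extra factor t raises (1 - x)^i to (1 - x)^(i+1).
  ι*shifted : ∀ k n → k < N →
    ι (suc k) * shifted k n ≈ ι (suc k) * shifted (suc k) n + sumTo N (λ i → esymm i (suc k) * sbinom (suc i) n)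
  ι*shifted k n k<N = begin
    u * (1# * c₀ + sumTo N (λ i → esymm (suc i) k * sbinom (suc i) n))
      ≈⟨ distribˡ _ _ _ ⟩
    u * (1# * c₀) + u * sumTo N (λ i → esymm (suc i) k * sbinom (suc i) n)
      ≈⟨ +-congˡ (sumTo-*ˡ N u _) ⟩
    u * (1# * c₀) + sumTo N (λ i → u * (esymm (suc i) k * sbinom (suc i) n))
      ≈⟨ +-congˡ (sumTo-cong N (λ i _ → begin
           u * (esymm (suc i) k * sbinom (suc i) n)
             ≈⟨ *-assoc _ _ _ ⟨
           u * esymm (suc i) k * sbinom (suc i) n
             ≈⟨ *-congʳ (ι*esymm i k k<N) ⟩
           (u * esymm (suc i) (suc k) + esymm i (suc k)) * sbinom (suc i) n
             ≈⟨ solve 4 (λ u x y z → (u :* x :+ y) :* z := u :* (x :* z) :+ y :* z) refl _ _ _ _ ⟩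
           u * (esymm (suc i) (suc k) * sbinom (suc i) n) + esymm i (suc k) * sbinom (suc i) n ∎)) ⟩
    u * (1# * c₀) + sumTo N (λ i → u * (esymm (suc i) (suc k) * sbinom (suc i) n) + esymm i (suc k) * sbinom (suc i) n)
      ≈⟨ +-congˡ (sumTo-+ N _ _) ⟩
    u * (1# * c₀) + (sumTo N (λ i → u * (esymm (suc i) (suc k) * sbinom (suc i) n)) + rest)
      ≈⟨ +-congˡ (+-congʳ (sumTo-*ˡ N u _)) ⟨
    u * (1# * c₀) + (u * sumTo N (λ i → esymm (suc i) (suc k) * sbinom (suc i) n) + rest)
      ≈⟨ solve 4 (λ u x y z → u :* x :+ (u :* y :+ z) := u :* (x :+ y) :+ z) refl _ _ _ _ ⟩
    u * shifted (suc k) n + rest ∎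
    where
    u = ι (suc k)
    c₀ = sbinom 0 n
    rest = sumTo N (λ i → esymm i (suc k) * sbinom (suc i) n)

  -- At x = 0 the product (k + 1) ∏ (j + 1)/j telescopes to N + 1. It supplies the constant term,
  -- which `shifted-equation` does not cover.
  ι*shifted-zero : ∀ d k → d ℕ.+ k ≡ N → ι (suc k) * shifted k 0 ≈ 0#
  ι*shifted-zero zero    k ≡.refl = trans (*-congʳ ι-char) (zeroˡ _)
  ι*shifted-zero (suc d) k d+k≡N  = begin
    ι (suc k) * shifted k 0                        ≈⟨ ι*shifted k 0 k<N ⟩
    ι (suc k) * shifted (suc k) 0 + sumTo N (λ i → esymm i (suc k) * 1#) ≈⟨ +-congˡ (shifted-drop k 0 k<N) ⟨
    ι (suc k) * shifted (suc k) 0 + shifted (suc k) 0 ≈⟨ solve 2 (λ u x → u :* x :+ x := (con (+ 1) :+ u) :* x) refl _ _ ⟩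
    ι (suc (suc k)) * shifted (suc k) 0            ≈⟨ ι*shifted-zero d (suc k) d+1+k≡N ⟩
    0#                                             ∎
    where
    d+1+k≡N = ≡.trans (ℕₚ.+-suc d k) d+k≡N
    k<N = ≡.subst (suc k ≤_) d+1+k≡N (ℕₚ.m≤n+m (suc k) d)

  -- Coefficient of x^(n+1) in (k + 1) G_k(1 - x) = (k + 2 - x) G_{k+1}(1 - x). The right side is
  -- the left side of `shifted-equation` at k + 1, which drives that induction.
  ι*shifted-suc : ∀ k n → k < N →
    ι (suc k) * shifted k (suc n) ≈ ι (suc (suc k)) * shifted (suc k) (suc n) - shifted (suc k) n
  ι*shifted-suc k n k<N = begin
    u * shifted k (suc n)
      ≈⟨ ι*shifted k (suc n) k<N ⟩
    u * x + sumTo N (λ i → esymm i (suc k) * (sbinom i (suc n) - sbinom i n))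
      ≈⟨ +-congˡ (sumTo-cong N (λ i _ → solve 3 (λ e y z → e :* (y :- z) := e :* y :- e :* z) refl _ _ _)) ⟩
    u * x + sumTo N (λ i → esymm i (suc k) * sbinom i (suc n) - esymm i (suc k) * sbinom i n)
      ≈⟨ +-congˡ (sumTo-minus N _ _) ⟩
    u * x + (sumTo N (λ i → esymm i (suc k) * sbinom i (suc n)) - sumTo N (λ i → esymm i (suc k) * sbinom i n))
      ≈⟨ +-congˡ (+-cong (shifted-drop k (suc n) k<N) (-‿cong (shifted-drop k n k<N))) ⟨
    u * x + (x - shifted (suc k) n)
      ≈⟨ solve 3 (λ u x y → u :* x :+ (x :- y) := (con (+ 1) :+ u) :* x :- y) refl _ _ _ ⟩
    ι (suc (suc k)) * x - shifted (suc k) n ∎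
    where
    u = ι (suc k)
    x = shifted (suc k) (suc n)

  -- Coefficientwise form of (k + 1 - x) G (1 - x) = (N + 1 - x) G (- x), in which N + 1 vanishes.
  shifted-equation : ∀ d k → d ℕ.+ k ≡ N → ∀ n →
    ι (suc k) * shifted k (suc n) - shifted k n ≈ - (sgn n * esymm n k)
  shifted-equation zero    k ≡.refl n = begin
    ι (suc N) * shifted N (suc n) - shifted N n  ≈⟨ +-cong (*-congʳ ι-char) (-‿cong (shifted-top n)) ⟩
    0# * shifted N (suc n) - sbinom 0 n          ≈⟨ solve 2 (λ x y → con (+ 0) :* x :- y := :- y) refl _ _ ⟩
    - sbinom 0 n                                 ≈⟨ -‿cong (lemma n) ⟩
    - (sgn n * esymm n N)                        ∎
    where
    lemma : ∀ n → sbinom 0 n ≈ sgn n * esymm n N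
    lemma zero    = sym (*-identityˡ 1#)
    lemma (suc n) = sym (trans (*-congˡ (esymm-top n)) (zeroʳ _))
  shifted-equation (suc d) k d+k≡N n = ι-cancel k<N (begin
    u * (u * shifted k (suc n) - shifted k n)
      ≈⟨ solve 3 (λ u x y → u :* (u :* x :- y) := u :* (u :* x) :- u :* y) refl _ _ _ ⟩
    u * (u * shifted k (suc n)) - u * shifted k n
      ≈⟨ +-congʳ (*-congˡ (next n)) ⟩
    u * - (sgn n * esymm n (suc k)) - u * shifted k n
      ≈⟨ finish n ⟩
    u * - (sgn n * esymm n k) ∎)
    where
    u = ι (suc k)
    d+1+k≡N = ≡.trans (ℕₚ.+-suc d k) d+k≡N
    k<N = ≡.subst (suc k ≤_) d+1+k≡N (ℕₚ.m≤n+m (suc k) d)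
    next : ∀ n → u * shifted k (suc n) ≈ - (sgn n * esymm n (suc k))
    next n = trans (ι*shifted-suc k n k<N) (shifted-equation d (suc k) d+1+k≡N n)
    finish : ∀ n → u * - (sgn n * esymm n (suc k)) - u * shifted k n ≈ u * - (sgn n * esymm n k)
    finish zero    = trans (+-congˡ (trans (-‿cong (ι*shifted-zero (suc d) k d+k≡N)) -0#≈0#)) (+-identityʳ _)
    finish (suc n) = begin
      u * - (- s * x) - u * shifted k (suc n)   ≈⟨ +-congˡ (-‿cong (next n)) ⟩
      u * - (- s * x) - - (s * y)               ≈⟨ solve 4 (λ u s x y → u :* :- (:- s :* x) :- :- (s :* y) := s :* (u :* x :+ y)) refl u s x y ⟩
      s * (u * x + y)                           ≈⟨ *-congˡ (ι*esymm n k k<N) ⟨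
      s * (u * esymm (suc n) k)                 ≈⟨ solve 3 (λ u s x → s :* (u :* x) := u :* :- (:- s :* x)) refl _ _ _ ⟩
      u * - (- s * esymm (suc n) k)             ∎
      where
      s = sgn n
      x = esymm (suc n) (suc k)
      y = esymm n (suc k)

  -- With N + 1 = 0, `shifted-equation` at k = 0 reads (1 - x) G(1 - x) = -x G(-x): the polynomial t
  -- G(t) is invariant under t ↦ t + 1. Here the coefficients of x^(n+1) are compared.
  lagrange : ∀ n → sumTo (suc N) (λ i → esymm i 0 * sbinom (suc i) (suc n)) ≈ esymm n 0 * sbinom (suc n) (suc n)
  lagrange n = begin
    sumTo (suc N) (λ i → esymm i 0 * (sbinom i (suc n) - sbinom i n))
      ≈⟨ sumTo-cong (suc N) (λ i _ → solve 3 (λ e y z → e :* (y :- z) := e :* y :- e :* z) refl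
           (esymm i 0) (sbinom i (suc n)) (sbinom i n)) ⟩
    sumTo (suc N) (λ i → esymm i 0 * sbinom i (suc n) - esymm i 0 * sbinom i n)
      ≈⟨ sumTo-minus (suc N) (λ i → esymm i 0 * sbinom i (suc n)) (λ i → esymm i 0 * sbinom i n) ⟩
    shifted 0 (suc n) - shifted 0 n
      ≈⟨ solve 2 (λ x y → x :- y := (con (+ 1) :+ con (+ 0)) :* x :- y) refl _ _ ⟩
    ι 1 * shifted 0 (suc n) - shifted 0 n
      ≈⟨ shifted-equation N 0 (ℕₚ.+-identityʳ N) n ⟩
    - (sgn n * esymm n 0)
      ≈⟨ solve 2 (λ s x → :- (s :* x) := x :* :- s) refl _ _ ⟩
    esymm n 0 * sgn (suc n)
      ≈⟨ *-congˡ (sbinom-diag (suc n)) ⟨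
    esymm n 0 * sbinom (suc n) (suc n) ∎

  -- Descending induction on the degree, `d` bounding its distance from N. In `lagrange n` the terms
  -- i < n are zero and i = n cancels the right side; those with n + 1 < i < N vanish by induction
  -- and i = N by its binomial. What remains is ±(n + 2) times the wanted value, and n + 2 ≤ N is
  -- invertible.
  esymm-vanish-from : ∀ d n → suc n < N → N ≤ suc n ℕ.+ d → esymm (suc n) 0 ≈ 0#
  esymm-vanish-from zero    n n<N N≤n = ⊥-elim (ℕₚ.<⇒≱ n<N (≡.subst (N ≤_) (ℕₚ.+-identityʳ (suc n)) N≤n))
  esymm-vanish-from (suc d) n n<N N≤n = ι-cancel n<N (begin
    u * e           ≈⟨ *-identityˡ _ ⟨
    1# * (u * e)    ≈⟨ *-congʳ (sgn² (suc n)) ⟨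
    s * s * (u * e) ≈⟨ solve 3 (λ s u e → s :* s :* (u :* e) := s :* (e :* (s :* u))) refl s u e ⟩
    s * (e * (s * u)) ≈⟨ *-congˡ vanish ⟩
    s * 0#          ≈⟨ solve 2 (λ s u → s :* con (+ 0) := u :* con (+ 0)) refl s u ⟩
    u * 0#          ∎)
    where
    u = ι (suc (suc n))
    s = sgn (suc n)
    e = esymm (suc n) 0
    x = esymm n 0 * sbinom (suc n) (suc n)
    others : ∀ i → i < suc N → i ≢ n → i ≢ suc n → esymm i 0 * sbinom (suc i) (suc n) ≈ 0#
    others i (s≤s i≤N) i≢n i≢1+n with ℕₚ.<-cmp i n
    ... | tri< i<n _ _ = trans (*-congˡ (sbinom-zero (suc i) (suc n) (s≤s i<n))) (zeroʳ _)
    ... | tri≈ _ i≡n _ = ⊥-elim (i≢n i≡n)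
    others i@(suc j) (s≤s i≤N) i≢n i≢1+n | tri> _ _ n<i with ℕₚ.m≤n⇒m<n∨m≡n i≤N
    ... | inj₁ i<N = trans (*-congʳ (esymm-vanish-from d j i<N bound)) (zeroˡ _)
      where
      bound : N ≤ suc j ℕ.+ d
      bound = ℕₚ.≤-trans N≤n (≡.subst (ℕ._≤ suc j ℕ.+ d) (≡.sym (ℕₚ.+-suc (suc n) d)) (ℕₚ.+-monoˡ-≤ d (ℕₚ.≤∧≢⇒< n<i (i≢1+n ∘ ≡.sym))))
    -- In degree N = p - 1 the symmetric function is a unit, so the induction cannot apply; the
    -- coefficient is zero instead, as p divides (p choose n + 1).
    ... | inj₂ ≡.refl = trans (*-congˡ (sbinom-char n (ℕₚ.<⇒≤ n<N))) (zeroʳ _)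
    vanish : e * (s * u) ≈ 0#
    vanish = begin
      e * (s * u)                                  ≈⟨ *-congˡ (sbinom-subdiag (suc n)) ⟨
      e * sbinom (suc (suc n)) (suc n)             ≈⟨ solve 2 (λ x y → y := (x :+ y) :- x) refl x _ ⟩
      (x + e * sbinom (suc (suc n)) (suc n)) - x   ≈⟨ +-congʳ (trans (sym (sumTo-two (suc N) n _ (s≤s (ℕₚ.<⇒≤ n<N)) others)) (lagrange n)) ⟩
      x - x                                        ≈⟨ -‿inverseʳ x ⟩
      0#                                           ∎

  esymm-vanish : ∀ n → suc n < N → esymm (suc n) 0 ≈ 0#
  esymm-vanish n n<N = esymm-vanish-from N n n<N (ℕₚ.m≤n+m N (suc n))

  -- The functional equation under x ↦ 1 - x

  diff : ℕ → ℕ → Carrier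
  diff m i = esymm m i - esymm m (suc i)

  -- `diff (suc m) i` is the coefficient of x^(i+1) in f_{m+1}: the products of m + 1 inverses whose
  -- least index is i + 1. So this is termwise differentiation, with `esymm m (suc i)` the
  -- coefficient of x^i in f_{m+1}′.
  ι*diff : ∀ m i → i < N → ι (suc i) * diff (suc m) i ≈ esymm m (suc i)
  ι*diff m i i<N = begin
    u * (esymm (suc m) i - y)      ≈⟨ solve 3 (λ u x y → u :* (x :- y) := u :* x :- u :* y) refl _ _ _ ⟩
    u * esymm (suc m) i - u * y    ≈⟨ +-congʳ (ι*esymm m i i<N) ⟩
    u * y + esymm m (suc i) - u * y ≈⟨ solve 2 (λ x y → x :+ y :- x := y) refl _ _ ⟩
    esymm m (suc i)                ∎
    where
    u = ι (suc i)
    y = esymm (suc m) (suc i)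

  -- dual and dual⁺ are the binomial transforms of the sequences diff m i placed at i and at i + 1,
  -- the former completed by esymm m N at N.
  dual : ℕ → ℕ → Carrier
  dual m k = sumTo N (λ i → diff m i * sbinom i k) + esymm m N * sbinom N k

  dual⁺ : ℕ → ℕ → Carrier
  dual⁺ m k = sumTo N (λ i → diff m i * sbinom (suc i) k)

  -- Let D be the polynomial with coefficients `diff m i`, completed by `esymm m N` at x^N.
  -- Multiplying f_{m+1}′ by 1 - x gives D(x) = `esymm m 0` - (1 - x) f_{m+1}′(x). Substituting 1 -
  -- x for x and comparing coefficients of x^(k+1) gives the claim.
  ι*dual⁺ : ∀ m k → ι (suc k) * dual⁺ (suc m) (suc k) ≈ dual m (suc k)
  ι*dual⁺ m k = begin
    u * sumTo N (λ i → diff (suc m) i * sbinom (suc i) (suc k))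
      ≈⟨ sumTo-*ˡ N u _ ⟩
    sumTo N (λ i → u * (diff (suc m) i * sbinom (suc i) (suc k)))
      ≈⟨ sumTo-cong N summand ⟩
    sumTo N (λ i → diff m i * sbinom i (suc k) - (f i - f (suc i)))
      ≈⟨ sumTo-minus N _ (λ i → f i - f (suc i)) ⟩
    sumTo N (λ i → diff m i * sbinom i (suc k)) - sumTo N (λ i → f i - f (suc i))
      ≈⟨ +-congˡ (-‿cong (sumTo-telescope N f)) ⟩
    -- The lower boundary term is zero because `sbinom 0 (suc k)` is; the upper one, `f N`, is the
    -- term that completes `dual`.
    sumTo N (λ i → diff m i * sbinom i (suc k)) - (esymm m 0 * 0# - f N)
      ≈⟨ solve 3 (λ x y z → x :- (y :* con (+ 0) :- z) := x :+ z) refl _ _ _ ⟩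
    dual m (suc k) ∎
    where
    u = ι (suc k)
    f : ℕ → Carrier
    f i = esymm m i * sbinom i (suc k)
    summand : ∀ i → i < N →
      u * (diff (suc m) i * sbinom (suc i) (suc k)) ≈ diff m i * sbinom i (suc k) - (f i - f (suc i))
    summand i i<N = begin
      u * (diff (suc m) i * sbinom (suc i) (suc k))
        ≈⟨ solve 3 (λ u d b → u :* (d :* b) := d :* (u :* b)) refl u (diff (suc m) i) (sbinom (suc i) (suc k)) ⟩
      diff (suc m) i * (u * sbinom (suc i) (suc k))
        ≈⟨ *-congˡ (sbinom-absorb i k) ⟩
      diff (suc m) i * - (ι (suc i) * sbinom i k)
        ≈⟨ solve 3 (λ u d b → d :* :- (u :* b) := :- (u :* d :* b)) refl (ι (suc i)) (diff (suc m) i) (sbinom i k) ⟩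
      - (ι (suc i) * diff (suc m) i * sbinom i k)
        ≈⟨ -‿cong (*-congʳ (ι*diff m i i<N)) ⟩
      - (esymm m (suc i) * sbinom i k)
        ≈⟨ solve 4 (λ x y b c → :- (y :* c) := (x :- y) :* b :- (x :* b :- y :* (b :- c))) refl
             (esymm m i) (esymm m (suc i)) (sbinom i (suc k)) (sbinom i k) ⟩
      diff m i * sbinom i (suc k) - (f i - f (suc i)) ∎

  -- This is f_{m+1}(1 - x) = (-1)^m f_{m+1}(x) away from the constant term: integration of the
  -- level-m statement, dividing by k + 1.
  dual⁺-reflect : ∀ m → (∀ k → k ≤ N → dual m k ≈ sgn m * esymm m k) →
    ∀ k → k < N → dual⁺ (suc m) (suc k) ≈ sgn m * diff (suc m) k
  dual⁺-reflect m dual-m k k<N = ι-cancel k<N (begin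
    u * dual⁺ (suc m) (suc k)      ≈⟨ ι*dual⁺ m k ⟩
    dual m (suc k)                 ≈⟨ dual-m (suc k) k<N ⟩
    sgn m * esymm m (suc k)        ≈⟨ *-congˡ (ι*diff m k k<N) ⟨
    sgn m * (u * diff (suc m) k)   ≈⟨ solve 3 (λ s u x → s :* (u :* x) := u :* (s :* x)) refl (sgn m) u (diff (suc m) k) ⟩
    u * (sgn m * diff (suc m) k)   ∎)
    where
    u = ι (suc k)

  -- The sum is f_{m+1}(1), which telescopes to the full symmetric function of degree m + 1.
  sumTo-diff : ∀ m → suc m < N → sumTo N (λ i → diff (suc m) i * 1#) ≈ 0#
  sumTo-diff m m<N = begin
    sumTo N (λ i → diff (suc m) i * 1#)   ≈⟨ sumTo-cong N (λ i _ → *-identityʳ (diff (suc m) i)) ⟩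
    sumTo N (diff (suc m))                ≈⟨ sumTo-telescope N (esymm (suc m)) ⟩
    esymm (suc m) 0 - esymm (suc m) N     ≈⟨ +-cong (esymm-vanish m m<N) (-‿cong (esymm-top m)) ⟩
    0# - 0#                               ≈⟨ -‿inverseʳ 0# ⟩
    0#                                    ∎

  -- For m > 0 this is the functional equation of f_m divided by 1 - x: `dual m` lists the
  -- coefficients of f_m(1 - x)/(1 - x), and those of -f_m(x)/(1 - x) are `esymm m k` because f_m(1)
  -- = 0. The recursion is on m, and within m on k.
  dual-esymm : ∀ m → m < N → ∀ k → k ≤ N → dual m k ≈ sgn m * esymm m k
  dual-esymm zero _ k k≤N = begin
    sumTo N (λ i → (1# - 1#) * sbinom i k) + 1# * sbinom N k
      ≈⟨ +-cong (sumTo-zero N (λ i _ → trans (*-congʳ (-‿inverseʳ 1#)) (zeroˡ _))) (*-congˡ (sbinom-top k k≤N)) ⟩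
    0# + 1# * 1#  ≈⟨ +-identityˡ _ ⟩
    1# * 1#       ∎
  dual-esymm (suc m) m<N zero k≤N = begin
    sumTo N (λ i → diff (suc m) i * 1#) + esymm (suc m) N * 1#
      ≈⟨ +-cong (sumTo-diff m m<N) (*-congʳ (esymm-top m)) ⟩
    0# + 0# * 1#             ≈⟨ solve 1 (λ s → con (+ 0) :+ con (+ 0) :* con (+ 1) := s :* con (+ 0)) refl _ ⟩
    sgn (suc m) * 0#                ≈⟨ *-congˡ (esymm-vanish m m<N) ⟨
    sgn (suc m) * esymm (suc m) 0   ∎
  dual-esymm (suc m) m<N (suc k) k<N = begin
    sumTo N (λ i → diff (suc m) i * sbinom i (suc k)) + e * sbinom N (suc k)
      -- Pascal's rule: (1 - x)^i = x (1 - x)^i + (1 - x)^(i+1), so each coefficient of the quotient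
      -- is the previous one plus a coefficient of f_{m+1}(1 - x).
      ≈⟨ +-cong (sumTo-cong N (λ i _ → solve 3 (λ d b c → d :* b := d :* c :+ d :* (b :- c)) refl
                   (diff (suc m) i) (sbinom i (suc k)) (sbinom i k)))
                (trans (*-congʳ (esymm-top m)) (zeroˡ _)) ⟩
    sumTo N (λ i → diff (suc m) i * sbinom i k + diff (suc m) i * sbinom (suc i) (suc k)) + 0#
      ≈⟨ +-congʳ (sumTo-+ N _ _) ⟩
    sumTo N (λ i → diff (suc m) i * sbinom i k) + dual⁺ (suc m) (suc k) + 0#
      ≈⟨ solve 3 (λ x y z → x :+ y :+ con (+ 0) := x :+ con (+ 0) :* z :+ y) refl _ _ _ ⟩
    sumTo N (λ i → diff (suc m) i * sbinom i k) + 0# * sbinom N k + dual⁺ (suc m) (suc k)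
      ≈⟨ +-congʳ (+-congˡ (*-congʳ (esymm-top m))) ⟨
    dual (suc m) k + dual⁺ (suc m) (suc k)
      ≈⟨ +-cong (dual-esymm (suc m) m<N k (ℕₚ.<⇒≤ k<N))
                (dual⁺-reflect m (dual-esymm m (ℕₚ.<⇒≤ m<N)) k k<N) ⟩
    sgn (suc m) * esymm (suc m) k + sgn m * diff (suc m) k
      ≈⟨ solve 3 (λ s x y → :- s :* x :+ s :* (x :- y) := :- s :* y) refl (sgn m) (esymm (suc m) k) (esymm (suc m) (suc k)) ⟩
    sgn (suc m) * esymm (suc m) (suc k) ∎
    where
    e = esymm (suc m) N

  -- Evaluation at a sixth root of unity by pairing

  pairing : ℕ → (ℕ → Carrier) → Carrier
  pairing m w = sumTo N (λ i → diff (suc m) i * w (suc i))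

  -- The binomial transform is moved from the sequence, where it is reversal, to the coefficients of
  -- f_{m+1}, where it is x ↦ 1 - x and acts as `sgn m`.
  pairing-reflect : ∀ m a b → suc m < N → pairing m (hexa a (a - b)) ≈ sgn m * pairing m (hexa a b)
  pairing-reflect m a b m<N = begin
    sumTo N (λ i → diff (suc m) i * hexa a (a - b) (suc i))
      ≈⟨ sumTo-cong N (λ i i<N → *-congˡ {diff (suc m) i} (hexa-transform (suc N) (suc i) a b (s≤s i<N))) ⟨
    sumTo N (λ i → diff (suc m) i * sumTo (suc N) (λ k → sbinom (suc i) k * h k))
      ≈⟨ sumTo-cong N (λ i _ → sumTo-*ˡ (suc N) (diff (suc m) i) (λ k → sbinom (suc i) k * h k)) ⟩
    sumTo N (λ i → sumTo (suc N) (λ k → diff (suc m) i * (sbinom (suc i) k * h k)))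
      ≈⟨ sumTo-swap N (suc N) (λ i k → diff (suc m) i * (sbinom (suc i) k * h k)) ⟩
    sumTo (suc N) (λ k → sumTo N (λ i → diff (suc m) i * (sbinom (suc i) k * h k)))
      ≈⟨ sumTo-cong (suc N) (λ k _ → trans
           (sumTo-cong N (λ i _ → solve 3 (λ d b w → d :* (b :* w) := w :* (d :* b)) refl
              (diff (suc m) i) (sbinom (suc i) k) (h k)))
           (sym (sumTo-*ˡ N (h k) (λ i → diff (suc m) i * sbinom (suc i) k)))) ⟩
    h 0 * dual⁺ (suc m) 0 + sumTo N (λ k → h (suc k) * dual⁺ (suc m) (suc k))
      ≈⟨ +-cong (trans (*-congˡ (sumTo-diff m m<N)) (zeroʳ _))
                (sumTo-cong N (λ k k<N → *-congˡ (dual⁺-reflect m (dual-esymm m (ℕₚ.<⇒≤ m<N)) k k<N))) ⟩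
    0# + sumTo N (λ k → h (suc k) * (sgn m * diff (suc m) k))
      ≈⟨ +-identityˡ _ ⟩
    sumTo N (λ k → h (suc k) * (sgn m * diff (suc m) k))
      ≈⟨ sumTo-cong N (λ k _ → solve 3 (λ w s d → w :* (s :* d) := s :* (d :* w)) refl
           (h (suc k)) (sgn m) (diff (suc m) k)) ⟩
    sumTo N (λ k → sgn m * (diff (suc m) k * h (suc k)))
      ≈⟨ sumTo-*ˡ N (sgn m) (λ k → diff (suc m) k * h (suc k)) ⟨
    sgn m * pairing m h ∎
    where
    h = hexa a b

  pairing-cong : ∀ m {v w} → (∀ i → v i ≈ w i) → pairing m v ≈ pairing m w
  pairing-cong m v≈w = sumTo-cong N (λ i _ → *-congˡ (v≈w (suc i)))

  halve : ∀ {x} → 1 < N → x ≈ - x → x ≈ 0#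
  halve {x} 1<N x≈-x = ι-cancel 1<N (begin
    ι 2 * x   ≈⟨ solve 1 (λ x → (con (+ 1) :+ (con (+ 1) :+ con (+ 0))) :* x := x :+ x) refl x ⟩
    x + x     ≈⟨ +-congˡ x≈-x ⟩
    x - x     ≈⟨ solve 1 (λ x → x :- x := (con (+ 1) :+ (con (+ 1) :+ con (+ 0))) :* con (+ 0)) refl x ⟩
    ι 2 * 0#  ∎)

  -- `hexa 0# 1#` stands for (ω^i - ω^-i)/(ω - ω^-1). Reversal negates it, while `pairing-reflect`
  -- has sign +1, so the pairing equals its own negative.
  pairing-odd : ∀ m → suc m < N → sgn m ≈ 1# → pairing m (hexa 0# 1#) ≈ 0#
  pairing-odd m m<N sgn≈1 = halve (ℕₚ.≤-<-trans (s≤s z≤n) m<N) (sym (begin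
    - pairing m h                                       ≈⟨ sumTo-neg N (λ i → diff (suc m) i * h (suc i)) ⟨
    sumTo N (λ i → - (diff (suc m) i * h (suc i)))      ≈⟨ sumTo-cong N (λ i _ → -‿distribʳ-* (diff (suc m) i) (h (suc i))) ⟩
    pairing m (λ i → - h i)                             ≈⟨ pairing-cong m (hexa-neg 0# 1#) ⟨
    pairing m (hexa (- 0#) (- 1#))                      ≈⟨ pairing-cong m (λ i → hexa-cong { - 0#} {0#} { - 1#} {0# - 1#} i -0#≈0# (sym (+-identityˡ _))) ⟩
    pairing m (hexa 0# (0# - 1#))                       ≈⟨ pairing-reflect m 0# 1# m<N ⟩
    sgn m * pairing m h                                 ≈⟨ *-congʳ sgn≈1 ⟩
    1# * pairing m h                                    ≈⟨ *-identityˡ _ ⟩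
    pairing m h                                         ∎))
    where
    h = hexa 0# 1#

  -- `hexa (ι 2) 1#` stands for ω^i + ω^-i. Reversal fixes it, while `pairing-reflect` has sign -1.
  -- The constant sequence pairs to f_{m+1}(1) = 0, so subtracting it costs nothing.
  pairing-even : ∀ m → suc m < N → sgn m ≈ - 1# → pairing m (λ i → hexa (ι 2) 1# i - 1#) ≈ 0#
  pairing-even m m<N sgn≈-1 = begin
    sumTo N (λ i → diff (suc m) i * (h (suc i) - 1#))
      ≈⟨ sumTo-cong N (λ i _ → solve 2 (λ d x → d :* (x :- con (+ 1)) := d :* x :- d :* con (+ 1)) refl (diff (suc m) i) (h (suc i))) ⟩
    sumTo N (λ i → diff (suc m) i * h (suc i) - diff (suc m) i * 1#)
      ≈⟨ sumTo-minus N _ _ ⟩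
    pairing m h - sumTo N (λ i → diff (suc m) i * 1#)
      ≈⟨ +-cong self-dual (-‿cong (sumTo-diff m m<N)) ⟩
    0# - 0#
      ≈⟨ -‿inverseʳ 0# ⟩
    0# ∎
    where
    h = hexa (ι 2) 1#
    self-dual : pairing m h ≈ 0#
    self-dual = halve (ℕₚ.≤-<-trans (s≤s z≤n) m<N) (begin
      pairing m h                       ≈⟨ pairing-cong m (λ i → hexa-cong {ι 2} {ι 2} {1#} {ι 2 - 1#} i refl
                                             (solve 0 (con (+ 1) := (con (+ 1) :+ (con (+ 1) :+ con (+ 0))) :- con (+ 1)) refl)) ⟩
      pairing m (hexa (ι 2) (ι 2 - 1#)) ≈⟨ pairing-reflect m (ι 2) 1# m<N ⟩
      sgn m * pairing m h               ≈⟨ *-congʳ sgn≈-1 ⟩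
      - 1# * pairing m h                ≈⟨ solve 1 (λ x → :- con (+ 1) :* x := :- x) refl _ ⟩
      - pairing m h                     ∎)

  diff≈inv*esymm : ∀ m i → i < N → diff (suc m) i ≈ inv (suc i) * esymm m (suc i)
  diff≈inv*esymm m i i<N = trans (+-congʳ (esymm-step m i i<N))
    (solve 2 (λ x y → x :+ y :- y := x) refl _ _)

-- Sums over tuples as iterated sums in ℚ

module ListSums where
  open CommutativeRing ℚₚ.+-*-commutativeRing using (+-assoc; +-identityˡ; zeroʳ; distribˡ)
  open RingLemmas ℚₚ.+-*-commutativeRing using (sumTo; when)

  total : {A : Set} → (A → ℚ) → List A → ℚ
  total f xs = List.foldr ℚ._+_ 0ℚ (List.map f xs)

  module _ {A : Set} where
    total-cong : ∀ {f g : A → ℚ} → (∀ x → f x ≡ g x) → ∀ xs → total f xs ≡ total g xs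
    total-cong f≗g xs = ≡.cong (List.foldr ℚ._+_ 0ℚ) (Listₚ.map-cong f≗g xs)

    total-++ : ∀ (f : A → ℚ) xs ys → total f (xs ++ ys) ≡ total f xs ℚ.+ total f ys
    total-++ f []       ys = ≡.sym (+-identityˡ _)
    total-++ f (x ∷ xs) ys = ≡.trans (≡.cong (f x ℚ.+_) (total-++ f xs ys)) (≡.sym (+-assoc (f x) _ _))

    total-filter : ∀ {P : A → Set} (P? : Decidable P) (f : A → ℚ) xs →
      total f (List.filter P? xs) ≡ total (λ x → when (does (P? x)) (f x)) xs
    total-filter P? f []       = ≡.refl
    total-filter P? f (x ∷ xs) with does (P? x)
    ... | true  = ≡.cong (f x ℚ.+_) (total-filter P? f xs)
    ... | false = ≡.trans (total-filter P? f xs) (≡.sym (+-identityˡ _))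

    total-* : ∀ a (f : A → ℚ) xs → total (λ x → a ℚ.* f x) xs ≡ a ℚ.* total f xs
    total-* a f []       = ≡.sym (zeroʳ a)
    total-* a f (x ∷ xs) = ≡.trans (≡.cong (a ℚ.* f x ℚ.+_) (total-* a f xs)) (≡.sym (distribˡ a (f x) _))

    total-when : ∀ b (f : A → ℚ) xs → total (λ x → when b (f x)) xs ≡ when b (total f xs)
    total-when true  f xs       = ≡.refl
    total-when false f []       = ≡.refl
    total-when false f (x ∷ xs) = ≡.trans (+-identityˡ _) (total-when false f xs)

    total-applyUpTo : ∀ (f : A → ℚ) g n → total f (List.applyUpTo g n) ≡ sumTo n (λ i → f (g i))
    total-applyUpTo f g zero    = ≡.refl
    total-applyUpTo f g (suc n) = ≡.cong (f (g 0) ℚ.+_) (total-applyUpTo f (g ∘ suc) n)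

  total-cartesianProductWith : ∀ {A B C : Set} (f : C → ℚ) (g : A → B → C) xs ys →
    total f (List.cartesianProductWith g xs ys) ≡ total (λ x → total (λ y → f (g x y)) ys) xs
  total-cartesianProductWith f g []       ys = ≡.refl
  total-cartesianProductWith f g (x ∷ xs) ys = ≡.trans
    (total-++ f (List.map (g x) ys) _)
    (≡.cong₂ ℚ._+_ (≡.cong (List.foldr ℚ._+_ 0ℚ) (≡.sym (Listₚ.map-∘ ys))) (total-cartesianProductWith f g xs ys))

  when-∧ : ∀ b c x → when (b ∧ c) x ≡ when b (when c x)
  when-∧ true  c x = ≡.refl
  when-∧ false c x = ≡.refl

  when-*ʳ : ∀ b x y → when b (x ℚ.* y) ≡ x ℚ.* when b y
  when-*ʳ true  x y = ≡.refl
  when-*ʳ false x y = ≡.sym (zeroʳ x)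

  -- The convention that division by zero gives 0 is multiplicative, so tuples containing 0 need no
  -- separate treatment.
  /-*-/ : ∀ a m b n → (a ÷ℕ m) ℚ.* (b ÷ℕ n) ≡ (a ℤ.* b) ÷ℕ (m ℕ.* n)
  /-*-/ a zero    b n       = ℚₚ.*-zeroˡ (b ÷ℕ n)
  /-*-/ a (suc m) b zero    = ≡.trans (ℚₚ.*-zeroʳ (a ℚ./ suc m)) (≡.cong ((a ℤ.* b) ÷ℕ_) (≡.sym (ℕₚ.*-zeroʳ m)))
  /-*-/ a (suc m) b (suc n) = ℚₚ.toℚᵘ-injective (begin
    ℚ.toℚᵘ (ℚ.fromℚᵘ x ℚ.* ℚ.fromℚᵘ y)          ≈⟨ ℚₚ.toℚᵘ-homo-* (ℚ.fromℚᵘ x) (ℚ.fromℚᵘ y) ⟩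
    ℚ.toℚᵘ (ℚ.fromℚᵘ x) ℚᵘ.* ℚ.toℚᵘ (ℚ.fromℚᵘ y) ≈⟨ ℚᵘₚ.*-cong (ℚₚ.toℚᵘ-fromℚᵘ x) (ℚₚ.toℚᵘ-fromℚᵘ y) ⟩
    x ℚᵘ.* y                                      ≈⟨ ℚₚ.toℚᵘ-fromℚᵘ (x ℚᵘ.* y) ⟨
    ℚ.toℚᵘ (ℚ.fromℚᵘ (x ℚᵘ.* y))                  ∎)
    where
    open SetoidReasoning ℚᵘₚ.≃-setoid
    x = ℚᵘ.mkℚᵘ a m
    y = ℚᵘ.mkℚᵘ b n

  /1-+ : ∀ a b → (a ℚ./ 1) ℚ.+ (b ℚ./ 1) ≡ (a ℤ.+ b) ℚ./ 1
  /1-+ a b = ℚₚ.toℚᵘ-injective (begin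
    ℚ.toℚᵘ (ℚ.fromℚᵘ x ℚ.+ ℚ.fromℚᵘ y)           ≈⟨ ℚₚ.toℚᵘ-homo-+ (ℚ.fromℚᵘ x) (ℚ.fromℚᵘ y) ⟩
    ℚ.toℚᵘ (ℚ.fromℚᵘ x) ℚᵘ.+ ℚ.toℚᵘ (ℚ.fromℚᵘ y) ≈⟨ ℚᵘₚ.+-cong (ℚₚ.toℚᵘ-fromℚᵘ x) (ℚₚ.toℚᵘ-fromℚᵘ y) ⟩
    x ℚᵘ.+ y                                      ≈⟨ ℚᵘ.*≡* (≡.cong (ℤ._* ℤ.1ℤ) (≡.cong₂ ℤ._+_ (ℤₚ.*-identityʳ a) (ℤₚ.*-identityʳ b))) ⟩
    ℚᵘ.mkℚᵘ (a ℤ.+ b) 0                           ≈⟨ ℚₚ.toℚᵘ-fromℚᵘ (ℚᵘ.mkℚᵘ (a ℤ.+ b) 0) ⟨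
    ℚ.toℚᵘ (ℚ.fromℚᵘ (ℚᵘ.mkℚᵘ (a ℤ.+ b) 0))       ∎)
    where
    open SetoidReasoning ℚᵘₚ.≃-setoid
    x = ℚᵘ.mkℚᵘ a 0
    y = ℚᵘ.mkℚᵘ b 0

  n÷n≡1 : ∀ n → + suc n ÷ℕ suc n ≡ 1ℚ
  n÷n≡1 n = ℚₚ.fromℚᵘ-cong {ℚᵘ.mkℚᵘ (+ suc n) n} {ℚᵘ.1ℚᵘ} (ℚᵘ.*≡* (ℤₚ.*-comm (+ suc n) ℤ.1ℤ))

  module _ (p : ℕ) where
    increasing : ∀ {n} → ℕ → Vec ℕ n → Bool
    increasing a is = does (linked? ℕₚ._<?_ (a ∷ (is ∷ʳ p)))

    chainSum : ℕ → ℕ → ℚ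
    chainSum n a = total (λ is → when (increasing a is) (ℤ.1ℤ ÷ℕ product is)) (tuples n (List.upTo p))

    chainSum-zero : ∀ a → a < p → chainSum 0 a ≡ 1ℚ
    chainSum-zero a a<p rewrite dec-true (a ℕₚ.<? p) a<p = ≡.refl

    -- The weight `w` of the first entry is left free so that one recursion serves both the plain
    -- sums `chainSum` and the sums whose first index carries a residue condition.
    total-tuples : ∀ n a (f : Vec ℕ (suc n) → ℚ) (w : ℕ → ℚ) →
      (∀ i is → f (i ∷ is) ≡ w i ℚ.* (ℤ.1ℤ ÷ℕ product is)) →
      total (λ is → when (increasing a is) (f is)) (tuples (suc n) (List.upTo p)) ≡
      sumTo p (λ i → when (a <ᵇ i) (w i ℚ.* chainSum n i))
    total-tuples n a f w f≡ = begin
      total (λ is → when (increasing a is) (f is)) (tuples (suc n) (List.upTo p))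
        ≡⟨ total-cartesianProductWith (λ is → when (increasing a is) (f is)) _∷_ (List.upTo p) (tuples n (List.upTo p)) ⟩
      total (λ i → total (λ is → when (increasing a (i ∷ is)) (f (i ∷ is))) ts) (List.upTo p)
        ≡⟨ total-cong inner (List.upTo p) ⟩
      total (λ i → when (a <ᵇ i) (w i ℚ.* chainSum n i)) (List.upTo p)
        ≡⟨ total-applyUpTo (λ i → when (a <ᵇ i) (w i ℚ.* chainSum n i)) (λ i → i) p ⟩
      sumTo p (λ i → when (a <ᵇ i) (w i ℚ.* chainSum n i)) ∎
      where
      open ≡.≡-Reasoning
      ts = tuples n (List.upTo p)
      inner : ∀ i → total (λ is → when (increasing a (i ∷ is)) (f (i ∷ is))) ts ≡ when (a <ᵇ i) (w i ℚ.* chainSum n i)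
      inner i = begin
        -- The decision made by `linked?` splits definitionally into its first comparison and the
        -- rest of the chain.
        total (λ is → when ((a <ᵇ i) ∧ increasing i is) (f (i ∷ is))) ts
          ≡⟨ total-cong (λ is → ≡.trans (when-∧ (a <ᵇ i) (increasing i is) (f (i ∷ is)))
               (≡.cong (when (a <ᵇ i)) (≡.trans (≡.cong (when (increasing i is)) (f≡ i is))
                 (when-*ʳ (increasing i is) (w i) _)))) ts ⟩
        total (λ is → when (a <ᵇ i) (w i ℚ.* when (increasing i is) (ℤ.1ℤ ÷ℕ product is))) ts
          ≡⟨ total-when (a <ᵇ i) _ ts ⟩
        when (a <ᵇ i) (total (λ is → w i ℚ.* when (increasing i is) (ℤ.1ℤ ÷ℕ product is)) ts)
          ≡⟨ ≡.cong (when (a <ᵇ i)) (total-* (w i) _ ts) ⟩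
        when (a <ᵇ i) (w i ℚ.* chainSum n i) ∎

    chainSum-suc : ∀ n a → chainSum (suc n) a ≡ sumTo p (λ i → when (a <ᵇ i) ((ℤ.1ℤ ÷ℕ i) ℚ.* chainSum n i))
    chainSum-suc n a = total-tuples n a (λ is → ℤ.1ℤ ÷ℕ product is) (ℤ.1ℤ ÷ℕ_)
      (λ i is → ≡.sym (/-*-/ ℤ.1ℤ i ℤ.1ℤ (product is)))

    ∑-chainSum : ∀ n m .{{_ : NonZero m}} R (g : ℕ → ℤ) →
      ∑ (suc n) p m R (λ is → g (first is) ÷ℕ product is) ≡
      sumTo p (λ i → when (0 <ᵇ i)
        (when (does (_∈?_ ℕₚ._≟_ (i % m) R)) (g i ℚ./ 1) ℚ.* (ℤ.1ℤ ÷ℕ i) ℚ.* chainSum n i))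
    ∑-chainSum n m R g = begin
      total h (List.filter (admissible? (suc n) p m R) (tuples (suc n) (List.upTo p)))
        ≡⟨ total-filter (admissible? (suc n) p m R) h (tuples (suc n) (List.upTo p)) ⟩
      total (λ is → when (does (admissible? (suc n) p m R is)) (h is)) (tuples (suc n) (List.upTo p))
        ≡⟨ total-cong (λ is → when-∧ (increasing 0 is) (r (first is)) (h is)) (tuples (suc n) (List.upTo p)) ⟩
      total (λ is → when (increasing 0 is) (when (r (first is)) (h is))) (tuples (suc n) (List.upTo p))
        ≡⟨ total-tuples n 0 (λ is → when (r (first is)) (h is)) (λ i → when (r i) (g i ℚ./ 1) ℚ.* (ℤ.1ℤ ÷ℕ i)) split ⟩
      sumTo p (λ i → when (0 <ᵇ i) (when (r i) (g i ℚ./ 1) ℚ.* (ℤ.1ℤ ÷ℕ i) ℚ.* chainSum n i)) ∎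
      where
      open ≡.≡-Reasoning
      h : Vec ℕ (suc n) → ℚ
      h is = g (first is) ÷ℕ product is
      r : ℕ → Bool
      r i = does (_∈?_ ℕₚ._≟_ (i % m) R)
      split : ∀ i is → when (r i) (h (i ∷ is)) ≡ when (r i) (g i ℚ./ 1) ℚ.* (ℤ.1ℤ ÷ℕ i) ℚ.* (ℤ.1ℤ ÷ℕ product is)
      split i is with r i
      ... | true  = ≡.sym (begin
        (g i ÷ℕ 1) ℚ.* (ℤ.1ℤ ÷ℕ i) ℚ.* (ℤ.1ℤ ÷ℕ product is)
          ≡⟨ ≡.cong (ℚ._* (ℤ.1ℤ ÷ℕ product is)) (/-*-/ (g i) 1 ℤ.1ℤ i) ⟩
        ((g i ℤ.* ℤ.1ℤ) ÷ℕ (1 ℕ.* i)) ℚ.* (ℤ.1ℤ ÷ℕ product is)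
          ≡⟨ /-*-/ (g i ℤ.* ℤ.1ℤ) (1 ℕ.* i) ℤ.1ℤ (product is) ⟩
        (g i ℤ.* ℤ.1ℤ ℤ.* ℤ.1ℤ) ÷ℕ (1 ℕ.* i ℕ.* product is)
          ≡⟨ ≡.cong₂ _÷ℕ_ (≡.trans (ℤₚ.*-identityʳ _) (ℤₚ.*-identityʳ (g i))) (≡.cong (ℕ._* product is) (ℕₚ.*-identityˡ i)) ⟩
        g i ÷ℕ (i ℕ.* product is) ∎)
      ... | false = ≡.sym (≡.trans (≡.cong (ℚ._* (ℤ.1ℤ ÷ℕ product is)) (ℚₚ.*-zeroˡ (ℤ.1ℤ ÷ℕ i))) (ℚₚ.*-zeroˡ (ℤ.1ℤ ÷ℕ product is)))

-- The ring of p-integral rationals with congruence modulo p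

module LocalRing (p : ℕ) (p-prime : Prime p) where
  open IntegerRingSolver ℚₚ.+-*-commutativeRing using (solve; _:=_; _:+_; _:*_; _:-_; :-_)

  ∤-* : ∀ {m n} → p ∤ m → p ∤ n → p ∤ m ℕ.* n
  ∤-* {m} {n} p∤m p∤n p∣mn with euclidsLemma m n p-prime p∣mn
  ... | inj₁ p∣m = p∤m p∣m
  ... | inj₂ p∣n = p∤n p∣n

  ∤1 : p ∤ 1
  ∤1 p∣1 = ¬prime[1] (≡.subst Prime (∣1⇒≡1 p∣1) p-prime)

  -- The reduced denominator divides d, with cofactor gcd(a, d).
  /-integral : ∀ a d .{{_ : NonZero d}} → p ∤ d → (a ℚ./ d) Integral-at p
  /-integral a d p∤d p∣↧ = p∤d (∣-trans p∣↧ (divides ℤ.∣ gcd a (+ d) ∣ (begin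
    d                                       ≡⟨ ≡.cong ℤ.∣_∣ (ℚₚ.↧-/ a d) ⟨
    ℤ.∣ (ℚ.↧ (a ℚ./ d)) ℤ.* gcd a (+ d) ∣   ≡⟨ ℤₚ.abs-* (ℚ.↧ (a ℚ./ d)) (gcd a (+ d)) ⟩
    ℚ.↧ₙ (a ℚ./ d) ℕ.* ℤ.∣ gcd a (+ d) ∣    ≡⟨ ℕₚ.*-comm (ℚ.↧ₙ (a ℚ./ d)) _ ⟩
    ℤ.∣ gcd a (+ d) ∣ ℕ.* ℚ.↧ₙ (a ℚ./ d)    ∎)))
    where open ≡.≡-Reasoning

  ÷ℕ-integral : ∀ a d → p ∤ d → (a ÷ℕ d) Integral-at p
  ÷ℕ-integral a zero    _   = ∤1
  ÷ℕ-integral a (suc d) p∤d = /-integral a (suc d) p∤d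

  +-integral : ∀ x y → x Integral-at p → y Integral-at p → (x ℚ.+ y) Integral-at p
  +-integral x@record{} y@record{} p∤x p∤y = /-integral (ℚ.↥ x ℤ.* ℚ.↧ y ℤ.+ ℚ.↥ y ℤ.* ℚ.↧ x) (ℚ.↧ₙ x ℕ.* ℚ.↧ₙ y) (∤-* p∤x p∤y)

  *-integral : ∀ x y → x Integral-at p → y Integral-at p → (x ℚ.* y) Integral-at p
  *-integral x@record{} y@record{} p∤x p∤y = /-integral (ℚ.↥ x ℤ.* ℚ.↥ y) (ℚ.↧ₙ x ℕ.* ℚ.↧ₙ y) (∤-* p∤x p∤y)

  neg-integral : ∀ x → x Integral-at p → (ℚ.- x) Integral-at p
  neg-integral x p∤x = ≡.subst (p ∤_) (≡.sym (≡.cong ℤ.∣_∣ (ℚₚ.↧-neg x))) p∤x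

  record ℤ₍ₚ₎ : Set where
    constructor _,_
    field
      value    : ℚ
      integral : value Integral-at p
  open ℤ₍ₚ₎ public

  infix 4 _≈_
  -- A record rather than the congruence itself, so that unification recovers `x` and `y` with their
  -- integrality proofs, which the underlying relation on rationals forgets.
  record _≈_ (x y : ℤ₍ₚ₎) : Set where
    constructor ⟪_⟫
    field congruent : value x ≡ value y [mod p ]
  open _≈_ public

  private
    P = + p ℚ./ 1

    from-≡ : ∀ {x y} → value x ≡ value y → x ≈ y
    from-≡ {x} {y} x≡y = ⟪ 0ℚ , ∤1 , (begin
      value x ℚ.- value y ≡⟨ ≡.cong (ℚ._- value y) x≡y ⟩
      value y ℚ.- value y ≡⟨ ℚₚ.+-inverseʳ (value y) ⟩
      0ℚ                  ≡⟨ ℚₚ.*-zeroʳ P ⟨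
      P ℚ.* 0ℚ            ∎) ⟫
      where open ≡.≡-Reasoning

    ≈-sym : ∀ {x y} → x ≈ y → y ≈ x
    ≈-sym {x} {y} ⟪ c , p∤c , eq ⟫ = ⟪ ℚ.- c , neg-integral c p∤c , (begin
      value y ℚ.- value x       ≡⟨ solve 2 (λ x y → y :- x := :- (x :- y)) ≡.refl (value x) (value y) ⟩
      ℚ.- (value x ℚ.- value y) ≡⟨ ≡.cong ℚ.-_ eq ⟩
      ℚ.- (P ℚ.* c)             ≡⟨ ℚₚ.neg-distribʳ-* P c ⟩
      P ℚ.* ℚ.- c               ∎) ⟫
      where open ≡.≡-Reasoning

    ≈-trans : ∀ {x y z} → x ≈ y → y ≈ z → x ≈ z
    ≈-trans {x} {y} {z} ⟪ c , p∤c , eq ⟫ ⟪ d , p∤d , eq′ ⟫ = ⟪ c ℚ.+ d , +-integral c d p∤c p∤d , (begin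
      value x ℚ.- value z
        ≡⟨ solve 3 (λ x y z → x :- z := x :- y :+ (y :- z)) ≡.refl (value x) (value y) (value z) ⟩
      value x ℚ.- value y ℚ.+ (value y ℚ.- value z)
        ≡⟨ ≡.cong₂ ℚ._+_ eq eq′ ⟩
      P ℚ.* c ℚ.+ P ℚ.* d
        ≡⟨ ℚₚ.*-distribˡ-+ P c d ⟨
      P ℚ.* (c ℚ.+ d) ∎) ⟫
      where open ≡.≡-Reasoning

    _+ₚ_ _*ₚ_ : ℤ₍ₚ₎ → ℤ₍ₚ₎ → ℤ₍ₚ₎
    (x , p∤x) +ₚ (y , p∤y) = x ℚ.+ y , +-integral x y p∤x p∤y
    (x , p∤x) *ₚ (y , p∤y) = x ℚ.* y , *-integral x y p∤x p∤y

    -ₚ_ : ℤ₍ₚ₎ → ℤ₍ₚ₎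
    -ₚ (x , p∤x) = ℚ.- x , neg-integral x p∤x

    +-cong : ∀ {x y u v} → x ≈ y → u ≈ v → x +ₚ u ≈ y +ₚ v
    +-cong {x} {y} {u} {v} ⟪ c , p∤c , eq ⟫ ⟪ d , p∤d , eq′ ⟫ = ⟪ c ℚ.+ d , +-integral c d p∤c p∤d , (begin
      value x ℚ.+ value u ℚ.- (value y ℚ.+ value v)
        ≡⟨ solve 4 (λ x y u v → x :+ u :- (y :+ v) := x :- y :+ (u :- v)) ≡.refl (value x) (value y) (value u) (value v) ⟩
      value x ℚ.- value y ℚ.+ (value u ℚ.- value v)
        ≡⟨ ≡.cong₂ ℚ._+_ eq eq′ ⟩
      P ℚ.* c ℚ.+ P ℚ.* d
        ≡⟨ ℚₚ.*-distribˡ-+ P c d ⟨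
      P ℚ.* (c ℚ.+ d) ∎) ⟫
      where open ≡.≡-Reasoning

    *-cong : ∀ {x y u v} → x ≈ y → u ≈ v → x *ₚ u ≈ y *ₚ v
    *-cong {x} {y} {u} {v} ⟪ c , p∤c , eq ⟫ ⟪ d , p∤d , eq′ ⟫ =
      ⟪ c ℚ.* value u ℚ.+ value y ℚ.* d
      , +-integral (c ℚ.* value u) (value y ℚ.* d) (*-integral c (value u) p∤c (integral u)) (*-integral (value y) d (integral y) p∤d)
      , (begin
      value x ℚ.* value u ℚ.- value y ℚ.* value v
        ≡⟨ solve 4 (λ x y u v → x :* u :- y :* v := (x :- y) :* u :+ y :* (u :- v)) ≡.refl (value x) (value y) (value u) (value v) ⟩
      (value x ℚ.- value y) ℚ.* value u ℚ.+ value y ℚ.* (value u ℚ.- value v)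
        ≡⟨ ≡.cong₂ (λ s t → s ℚ.* value u ℚ.+ value y ℚ.* t) eq eq′ ⟩
      P ℚ.* c ℚ.* value u ℚ.+ value y ℚ.* (P ℚ.* d)
        ≡⟨ solve 5 (λ P c u y d → P :* c :* u :+ y :* (P :* d) := P :* (c :* u :+ y :* d)) ≡.refl P c (value u) (value y) d ⟩
      P ℚ.* (c ℚ.* value u ℚ.+ value y ℚ.* d) ∎) ⟫
      where open ≡.≡-Reasoning

    -‿cong : ∀ {x y} → x ≈ y → -ₚ x ≈ -ₚ y
    -‿cong {x} {y} ⟪ c , p∤c , eq ⟫ = ⟪ ℚ.- c , neg-integral c p∤c , (begin
      ℚ.- value x ℚ.- ℚ.- value y ≡⟨ solve 2 (λ x y → :- x :- :- y := :- (x :- y)) ≡.refl (value x) (value y) ⟩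
      ℚ.- (value x ℚ.- value y)   ≡⟨ ≡.cong ℚ.-_ eq ⟩
      ℚ.- (P ℚ.* c)               ≡⟨ ℚₚ.neg-distribʳ-* P c ⟩
      P ℚ.* ℚ.- c                 ∎) ⟫
      where open ≡.≡-Reasoning

  -- As a setoid this is the field with p elements, but its representatives remain rationals, so
  -- results about it are literally congruences of rational sums.
  localRing : CommutativeRing _ _
  localRing = record
    { Carrier = ℤ₍ₚ₎
    ; _≈_ = _≈_
    ; _+_ = _+ₚ_
    ; _*_ = _*ₚ_
    ; -_ = -ₚ_
    ; 0# = 0ℚ , ∤1
    ; 1# = 1ℚ , ∤1
    ; isCommutativeRing = record
      { isRing = record
        { +-isAbelianGroup = record
          { isGroup = record
            { isMonoid = record
              { isSemigroup = record
                { isMagma = record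
                  { isEquivalence = record { refl = from-≡ ≡.refl ; sym = ≈-sym ; trans = ≈-trans }
                  ; ∙-cong = +-cong
                  }
                ; assoc = λ x y z → from-≡ (ℚₚ.+-assoc (value x) (value y) (value z))
                }
              ; identity = (λ x → from-≡ (ℚₚ.+-identityˡ (value x))) , (λ x → from-≡ (ℚₚ.+-identityʳ (value x)))
              }
            ; inverse = (λ x → from-≡ (ℚₚ.+-inverseˡ (value x))) , (λ x → from-≡ (ℚₚ.+-inverseʳ (value x)))
            ; ⁻¹-cong = -‿cong
            }
          ; comm = λ x y → from-≡ (ℚₚ.+-comm (value x) (value y))
          }
        ; *-cong = *-cong
        ; *-assoc = λ x y z → from-≡ (ℚₚ.*-assoc (value x) (value y) (value z))
        ; *-identity = (λ x → from-≡ (ℚₚ.*-identityˡ (value x))) , (λ x → from-≡ (ℚₚ.*-identityʳ (value x)))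
        ; distrib = (λ x y z → from-≡ (ℚₚ.*-distribˡ-+ (value x) (value y) (value z)))
                  , (λ x y z → from-≡ (ℚₚ.*-distribʳ-+ (value x) (value y) (value z)))
        }
      ; *-comm = λ x y → from-≡ (ℚₚ.*-comm (value x) (value y))
      }
    }

  module L = RingLemmas localRing
  module Q = RingLemmas ℚₚ.+-*-commutativeRing
  open ListSums using (/1-+; /-*-/; n÷n≡1)

  value-ι : ∀ n → value (L.ι n) ≡ + n ℚ./ 1
  value-ι zero    = ≡.refl
  value-ι (suc n) = ≡.trans (≡.cong (1ℚ ℚ.+_) (value-ι n)) (/1-+ (+ 1) (+ n))

  value-sgn : ∀ n → value (L.sgn n) ≡ (ℤ.-1ℤ ℤ.^ n) ℚ./ 1
  value-sgn zero    = ≡.refl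
  value-sgn (suc n) = begin
    ℚ.- value (L.sgn n)                   ≡⟨ ≡.cong ℚ.-_ (value-sgn n) ⟩
    ℚ.- ((ℤ.-1ℤ ℤ.^ n) ℚ./ 1)             ≡⟨ ℚₚ.*-identityˡ _ ⟨
    1ℚ ℚ.* ℚ.- ((ℤ.-1ℤ ℤ.^ n) ℚ./ 1)      ≡⟨ solve 2 (λ x y → x :* :- y := :- x :* y) ≡.refl 1ℚ ((ℤ.-1ℤ ℤ.^ n) ℚ./ 1) ⟩
    (ℤ.-1ℤ ÷ℕ 1) ℚ.* ((ℤ.-1ℤ ℤ.^ n) ÷ℕ 1) ≡⟨ /-*-/ ℤ.-1ℤ 1 (ℤ.-1ℤ ℤ.^ n) 1 ⟩
    (ℤ.-1ℤ ℤ.* ℤ.-1ℤ ℤ.^ n) ℚ./ 1         ∎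
    where open ≡.≡-Reasoning

  value-when : ∀ b x → value (L.when b x) ≡ Q.when b (value x)
  value-when true  x = ≡.refl
  value-when false x = ≡.refl

  value-sumTo : ∀ n f → value (L.sumTo n f) ≡ Q.sumTo n (λ i → value (f i))
  value-sumTo zero    f = ≡.refl
  value-sumTo (suc n) f = ≡.cong (value (f 0) ℚ.+_) (value-sumTo n (f ∘ suc))

  ι-char : L.ι p ≈ (0ℚ , ∤1)
  ι-char = ⟪ 1ℚ , ∤1 , (begin
    value (L.ι p) ℚ.- 0ℚ ≡⟨ ℚₚ.+-identityʳ (value (L.ι p)) ⟩
    value (L.ι p)        ≡⟨ value-ι p ⟩
    P                    ≡⟨ ℚₚ.*-identityʳ P ⟨
    P ℚ.* 1ℚ             ∎) ⟫
    where open ≡.≡-Reasoning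

  -- The value 0 at multiples of p only makes the function total; the indices 1, ..., p - 1 get
  -- their true reciprocals.
  inv : ℕ → ℤ₍ₚ₎
  inv k with p ∣? k
  ... | yes _   = 0ℚ , ∤1
  ... | no  p∤k = ℤ.1ℤ ÷ℕ k , ÷ℕ-integral ℤ.1ℤ k p∤k

  value-inv : ∀ k → p ∤ k → value (inv k) ≡ ℤ.1ℤ ÷ℕ k
  value-inv k p∤k with p ∣? k
  ... | yes p∣k = ⊥-elim (p∤k p∣k)
  ... | no  _   = ≡.refl

  value-inv-suc : ∀ k → suc k < p → value (inv (suc k)) ≡ ℤ.1ℤ ÷ℕ suc k
  value-inv-suc k 1+k<p = value-inv (suc k) (>⇒∤ 1+k<p)

  ι-inverse : ∀ k → suc k < p → L.ι (suc k) *ₚ inv (suc k) ≈ (1ℚ , ∤1)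
  ι-inverse k 1+k<p = from-≡ (begin
    value (L.ι (suc k)) ℚ.* value (inv (suc k))  ≡⟨ ≡.cong₂ ℚ._*_ (value-ι (suc k)) (value-inv-suc k 1+k<p) ⟩
    (+ suc k ÷ℕ 1) ℚ.* (ℤ.1ℤ ÷ℕ suc k)           ≡⟨ /-*-/ (+ suc k) 1 ℤ.1ℤ (suc k) ⟩
    (+ suc k ℤ.* ℤ.1ℤ) ÷ℕ (1 ℕ.* suc k)          ≡⟨ ≡.cong₂ _÷ℕ_ (ℤₚ.*-identityʳ (+ suc k)) (ℕₚ.*-identityˡ (suc k)) ⟩
    + suc k ÷ℕ suc k                             ≡⟨ n÷n≡1 k ⟩
    1ℚ                                           ∎)
    where open ≡.≡-Reasoning

-- Residue conditions as sequences of period six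

residue : ∀ m .{{_ : NonZero m}} → List ℕ → ℕ → Bool
residue m R i = does (_∈?_ ℕₚ._≟_ (i % m) R)

module Periodicity {c ℓ} (R : CommutativeRing c ℓ) where
  open CommutativeRing R hiding (zero)
  open IntegerRingSolver R
  open RingLemmas R
  open import Algebra.Properties.Ring ring using (-‿involutive)

  private
    2′ : ∀ {n} → Polynomial n
    2′ = con (+ 1) :+ (con (+ 1) :+ con (+ 0))

  sgn-even : ∀ n → 2 ∣ n → sgn n ≈ 1#
  sgn-even zero          _   = refl
  sgn-even (suc zero)    2∣1 = contradiction (∣1⇒≡1 2∣1) λ ()
  sgn-even (suc (suc n)) 2∣n = trans (-‿involutive _) (sgn-even n (∣m+n∣m⇒∣n 2∣n ∣-refl))

  sgn-odd : ∀ n → 2 ∤ n → sgn n ≈ - 1#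
  sgn-odd zero          2∤0 = contradiction (2 ∣0) 2∤0
  sgn-odd (suc zero)    _   = refl
  sgn-odd (suc (suc n)) 2∤n = trans (-‿involutive _) (sgn-odd n (2∤n ∘ ∣m∣n⇒∣m+n ∣-refl))

  when-cong : ∀ b {x y} → x ≈ y → when b x ≈ when b y
  when-cong true  x≈y = x≈y
  when-cong false x≈y = refl

  hexa-period : ∀ a b i → hexa a b (6 ℕ.+ i) ≈ hexa a b i
  hexa-period a b i = hexa-cong i
    (solve 2 (λ a b → let c = b :- a; d = c :- b; e = d :- c; f = e :- d in f :- e := a) refl a b)
    (solve 2 (λ a b → let c = b :- a; d = c :- b; e = d :- c; f = e :- d; g = f :- e in g :- f := b) refl a b)

  -- Both sides run through 0, 1, 1, 0, -1, -1.
  hexa-0-1 : ∀ i → when (residue 6 (1 ∷ 2 ∷ []) i) 1# - when (residue 6 (4 ∷ 5 ∷ []) i) 1# ≈ hexa 0# 1# i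
  hexa-0-1 0 = solve 0 (con (+ 0) :- con (+ 0) := con (+ 0)) refl
  hexa-0-1 1 = solve 0 (con (+ 1) :- con (+ 0) := con (+ 1)) refl
  hexa-0-1 2 = refl
  hexa-0-1 3 = solve 0 (con (+ 0) :- con (+ 0) := con (+ 1) :- con (+ 0) :- con (+ 1)) refl
  hexa-0-1 4 = solve 0 (let c = con (+ 1) :- con (+ 0); d = c :- con (+ 1) in
    con (+ 0) :- con (+ 1) := d :- c) refl
  hexa-0-1 5 = solve 0 (let c = con (+ 1) :- con (+ 0); d = c :- con (+ 1); e = d :- c in
    con (+ 0) :- con (+ 1) := e :- d) refl
  -- `(6 + i) % 6` computes to `i % 6`, so only the right side has to be shifted.
  hexa-0-1 (suc (suc (suc (suc (suc (suc i)))))) = trans (hexa-0-1 i) (sym (hexa-period 0# 1# i))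

  -- Both sides run through 1, 0, -2, -3, -2, 0. Subtracting 1 makes the values at residues 1 and 5
  -- vanish; the -3 at residue 3 is shared as -1 from the sign and -2 from the second sum.
  hexa-2-1 : ∀ i →
    when (residue 3 (0 ∷ []) i) (sgn i) - ι 2 * when (residue 6 (2 ∷ 3 ∷ 4 ∷ []) i) 1# ≈ hexa (ι 2) 1# i - 1#
  hexa-2-1 0 = solve 0 (con (+ 1) :- 2′ :* con (+ 0) := 2′ :- con (+ 1)) refl
  hexa-2-1 1 = solve 0 (con (+ 0) :- 2′ :* con (+ 0) := con (+ 1) :- con (+ 1)) refl
  hexa-2-1 2 = solve 0 (con (+ 0) :- 2′ :* con (+ 1) := con (+ 1) :- 2′ :- con (+ 1)) refl
  hexa-2-1 3 = solve 0 (let c = con (+ 1) :- 2′ in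
    :- :- :- con (+ 1) :- 2′ :* con (+ 1) := c :- con (+ 1) :- con (+ 1)) refl
  hexa-2-1 4 = solve 0 (let c = con (+ 1) :- 2′; d = c :- con (+ 1) in
    con (+ 0) :- 2′ :* con (+ 1) := d :- c :- con (+ 1)) refl
  hexa-2-1 5 = solve 0 (let c = con (+ 1) :- 2′; d = c :- con (+ 1); e = d :- c in
    con (+ 0) :- 2′ :* con (+ 0) := e :- d :- con (+ 1)) refl
  hexa-2-1 (suc (suc (suc (suc (suc (suc i)))))) = trans
    (+-congʳ (when-cong (residue 3 (0 ∷ []) i) (solve 1 (λ s → :- :- :- :- :- :- s := s) refl (sgn i))))
    (trans (hexa-2-1 i) (+-congʳ (sym (hexa-period (ι 2) 1# i))))

-- The two congruences

module Congruences (N : ℕ) (p-prime : Prime (suc N)) where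
  open LocalRing (suc N) p-prime
  open CommutativeRing localRing
    using (_*_; _-_; 0#; 1#; +-cong; +-congˡ; *-congˡ; *-congʳ; -‿cong; *-assoc; *-comm;
           setoid; refl; sym; trans; ring; +-group)
  open import Algebra.Properties.Group +-group using (x∙y⁻¹≈ε⇒x≈y)
  open import Algebra.Properties.Ring ring using (-‿injective; -‿involutive)
  open IntegerRingSolver localRing
  open Periodicity localRing
  open Reciprocals localRing N inv (λ k k<N → ι-inverse k (s≤s k<N)) ι-char
  open RingLemmas localRing using (hexa; sumTo; when; sgn; ι; sumTo-cong; sumTo-minus; sumTo-*ˡ)
  open ListSums using (chainSum; chainSum-zero; chainSum-suc; ∑-chainSum)
  open SetoidReasoning setoid

  -- An equality of rationals, not merely a congruence: `value` respects the ring operations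
  -- definitionally, and every index that survives the cut-off has its true reciprocal.
  value-esymm : ∀ n a → a < suc N → value (esymm n a) ≡ chainSum (suc N) n a
  value-esymm zero    a a<p = ≡.sym (chainSum-zero (suc N) a a<p)
  value-esymm (suc n) a a<p = ≡.trans (value-sumTo (suc N) (λ i → when (a <ᵇ i) (inv i * esymm n i)))
    (≡.trans (Q.sumTo-cong (suc N) summand) (≡.sym (chainSum-suc (suc N) n a)))
    where
    summand : ∀ i → i < suc N →
      value (when (a <ᵇ i) (inv i * esymm n i)) ≡ Q.when (a <ᵇ i) ((1ℤ ÷ℕ i) ℚ.* chainSum (suc N) n i)
    summand zero    _     = ≡.refl
    summand (suc i) 1+i<p = ≡.trans (value-when (a <ᵇ suc i) _)
      (≡.cong (Q.when (a <ᵇ suc i)) (≡.cong₂ ℚ._*_ (value-inv-suc i 1+i<p) (value-esymm n (suc i) 1+i<p)))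

  weighted : ℕ → (ℕ → ℤ₍ₚ₎) → ℤ₍ₚ₎
  weighted n w = sumTo N (λ i → w (suc i) * inv (suc i) * esymm n (suc i))

  weighted≈pairing : ∀ n w → weighted n w ≈ pairing n w
  weighted≈pairing n w = sumTo-cong N (λ i i<N → begin
    w (suc i) * inv (suc i) * esymm n (suc i)    ≈⟨ *-assoc (w (suc i)) (inv (suc i)) (esymm n (suc i)) ⟩
    w (suc i) * (inv (suc i) * esymm n (suc i))  ≈⟨ *-comm (w (suc i)) (inv (suc i) * esymm n (suc i)) ⟩
    inv (suc i) * esymm n (suc i) * w (suc i)    ≈⟨ *-congʳ {w (suc i)} (diff≈inv*esymm n i i<N) ⟨
    diff (suc n) i * w (suc i)                   ∎)

  ∑-weighted : ∀ n m .{{_ : NonZero m}} R (g : ℕ → ℤ) (G : ℕ → ℤ₍ₚ₎) →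
    (∀ i → value (G i) ≡ g i ℚ./ 1) →
    ∑ (suc n) (suc N) m R (λ is → g (first is) ÷ℕ product is) ≡ value (weighted n (λ i → when (residue m R i) (G i)))
  -- The term of index 0 is cut off and contributes `0ℚ`; dropping it leaves the indices 1, ..., N
  -- used by `weighted`.
  ∑-weighted n m R g G G≡g = ≡.trans (∑-chainSum (suc N) n m R g) (≡.trans (ℚₚ.+-identityˡ _)
    (≡.sym (≡.trans (value-sumTo N _) (Q.sumTo-cong N (λ i i<N → ≡.cong₂ ℚ._*_ (≡.cong₂ ℚ._*_
      (≡.trans (value-when (residue m R (suc i)) (G (suc i))) (≡.cong (Q.when (residue m R (suc i))) (G≡g (suc i))))
      (value-inv-suc i (s≤s i<N)))
      (value-esymm n (suc i) (s≤s i<N)))))))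

  pairing-minus : ∀ n v w → pairing n (λ i → v i - w i) ≈ pairing n v - pairing n w
  pairing-minus n v w = trans
    (sumTo-cong N (λ i _ → solve 3 (λ d x y → d :* (x :- y) := d :* x :- d :* y) refl
      (diff (suc n) i) (v (suc i)) (w (suc i))))
    (sumTo-minus N (λ i → diff (suc n) i * v (suc i)) (λ i → diff (suc n) i * w (suc i)))

  pairing-* : ∀ n x w → pairing n (λ i → x * w i) ≈ x * pairing n w
  pairing-* n x w = trans
    (sumTo-cong N (λ i _ → solve 3 (λ d x y → d :* (x :* y) := x :* (d :* y)) refl (diff (suc n) i) x (w (suc i))))
    (sym (sumTo-*ˡ N x (λ i → diff (suc n) i * w (suc i))))

  odd-case : ∀ n → suc n < N → 2 ∤ suc n →
    weighted n (λ i → when (residue 6 (1 ∷ 2 ∷ []) i) 1#) ≈ weighted n (λ i → when (residue 6 (4 ∷ 5 ∷ []) i) 1#)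
  odd-case n n<N 2∤n = x∙y⁻¹≈ε⇒x≈y (weighted n v) (weighted n w) (begin
    weighted n v - weighted n w       ≈⟨ +-cong (weighted≈pairing n v) (-‿cong (weighted≈pairing n w)) ⟩
    pairing n v - pairing n w         ≈⟨ pairing-minus n v w ⟨
    pairing n (λ i → v i - w i)       ≈⟨ pairing-cong n hexa-0-1 ⟩
    -- The depth of the sum is `suc n`, so an odd depth means that `sgn n` is 1.
    pairing n (hexa 0# 1#)   ≈⟨ pairing-odd n n<N (-‿injective (sgn-odd (suc n) 2∤n)) ⟩
    0#                                ∎)
    where
    v w : ℕ → ℤ₍ₚ₎
    v i = when (residue 6 (1 ∷ 2 ∷ []) i) 1#
    w i = when (residue 6 (4 ∷ 5 ∷ []) i) 1#

  even-case : ∀ n → suc n < N → 2 ∣ suc n →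
    weighted n (λ i → when (residue 3 (0 ∷ []) i) (sgn i)) ≈
    ι 2 * weighted n (λ i → when (residue 6 (2 ∷ 3 ∷ 4 ∷ []) i) 1#)
  even-case n n<N 2∣n = x∙y⁻¹≈ε⇒x≈y (weighted n v) (ι 2 * weighted n w) (begin
    weighted n v - ι 2 * weighted n w ≈⟨ +-cong (weighted≈pairing n v) (-‿cong (*-congˡ {ι 2} (weighted≈pairing n w))) ⟩
    pairing n v - ι 2 * pairing n w   ≈⟨ +-congˡ {pairing n v} (-‿cong (pairing-* n (ι 2) w)) ⟨
    pairing n v - pairing n (λ i → ι 2 * w i) ≈⟨ pairing-minus n v (λ i → ι 2 * w i) ⟨
    pairing n (λ i → v i - ι 2 * w i) ≈⟨ pairing-cong n hexa-2-1 ⟩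
    pairing n (λ i → hexa (ι 2) 1# i - 1#)
      ≈⟨ pairing-even n n<N (trans (sym (-‿involutive (sgn n))) (-‿cong (sgn-even (suc n) 2∣n))) ⟩
    0#                                ∎)
    where
    v w : ℕ → ℤ₍ₚ₎
    v i = when (residue 3 (0 ∷ []) i) (sgn i)
    w i = when (residue 6 (2 ∷ 3 ∷ 4 ∷ []) i) 1#

  odd-congruence : ∀ n → suc n < N → 2 ∤ suc n →
    ∑ (suc n) (suc N) 6 (1 ∷ 2 ∷ []) (λ is → 1ℤ ÷ℕ product is)
      ≡ ∑ (suc n) (suc N) 6 (4 ∷ 5 ∷ []) (λ is → 1ℤ ÷ℕ product is) [mod suc N ]
  odd-congruence n n<N 2∤n = ≡.subst₂ (λ x y → x ≡ y [mod suc N ])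
    (≡.sym (∑-weighted n 6 (1 ∷ 2 ∷ []) (λ _ → 1ℤ) (λ _ → 1#) (λ _ → ≡.refl)))
    (≡.sym (∑-weighted n 6 (4 ∷ 5 ∷ []) (λ _ → 1ℤ) (λ _ → 1#) (λ _ → ≡.refl)))
    (congruent (odd-case n n<N 2∤n))

  even-congruence : ∀ n → suc n < N → 2 ∣ suc n →
    ∑ (suc n) (suc N) 3 (0 ∷ []) (λ is → (-1ℤ ^ first is) ÷ℕ product is)
      ≡ (+ 2 / 1) ℚ.* ∑ (suc n) (suc N) 6 (2 ∷ 3 ∷ 4 ∷ []) (λ is → 1ℤ ÷ℕ product is) [mod suc N ]
  even-congruence n n<N 2∣n = ≡.subst₂ (λ x y → x ≡ y [mod suc N ])
    (≡.sym (∑-weighted n 3 (0 ∷ []) (-1ℤ ^_) sgn value-sgn))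
    (≡.sym (≡.cong ((+ 2 / 1) ℚ.*_) (∑-weighted n 6 (2 ∷ 3 ∷ 4 ∷ []) (λ _ → 1ℤ) (λ _ → 1#) (λ _ → ≡.refl))))
    (congruent (even-case n n<N 2∣n))

open import Data.Nat.Base using (_+_)
open import Data.Product.Base using (_×_)
open import Data.Rational.Base using (_*_)

theorem1p1 : ∀ (n : ℕ) .{{_ : NonZero n}} (p : ℕ) → Prime p → n + 1 < p →
    (2 ∤ n →
    ∑ n p 6 (1 ∷ 2 ∷ []) (λ is → 1ℤ ÷ℕ product is)
    ≡ ∑ n p 6 (4 ∷ 5 ∷ []) (λ is → 1ℤ ÷ℕ product is) [mod p ])
    × (2 ∣ n →
    ∑ n p 3 (0 ∷ []) (λ is → (-1ℤ ^ first is) ÷ℕ product is)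
    ≡ (+ 2 / 1) * ∑ n p 6 (2 ∷ 3 ∷ 4 ∷ []) (λ is → 1ℤ ÷ℕ product is) [mod p ])
theorem1p1 zero (suc N) p-prime n+1<p = ⊥-elim (ℕ.≢-nonZero⁻¹ 0 ≡.refl)
theorem1p1 (suc n) (suc N) p-prime (s≤s n+1≤N) = odd-congruence n n<N , even-congruence n n<N
  where
  open Congruences N p-prime
  -- The hypothesis says that the depth is below p - 1 = N, the range in which the symmetric
  -- functions vanish.
  n<N : suc n < N
  n<N = ≡.subst (ℕ._≤ N) (ℕₚ.+-comm (suc n) 1) n+1≤N
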